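{- Let $A,B\in\mathbb{Q}$ with $AB\neq0$, and suppose that $x^4+Ax+B$ has the rational non-zero root $v$. Then reducibility over $\mathbb{Q}$ of $(x^8+Ax^2+B)/(x^2-v)$ implies that this polynomial has reducibility type $(3,3)$, and this occurs precisely when, up to scaling, $$A=-\frac{(q^2+2q-1)(9q^2-10q+3)}{4},\qquad B=\frac{(q-1)^2(2q-1)(3q-1)^2}{4}$$ for some $q\in\mathbb{Q}$ with $q\neq1,\tfrac12,\tfrac13$.
   Context: A monic polynomial in $\mathbb{Q}[x]$ has reducibility type $(n_1,\dots,n_k)$, $n_1\le\dots\le n_k$, if it factors as a product of $k$ irreducible polynomials in $\mathbb{Q}[x]$ of degrees $n_1,\dots,n_k$. Trinomials are considered up to scaling: $x^8+Ax^2+B$ may be replaced by $x^8+A\lambda^6x^2+B\lambda^8$ with $\lambda\in\mathbb{Q}\setminus\{0\}$ (and correspondingly $v$ by $\lambda^2v$).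
   Formalization: For "reducibility implies type (3,3)", v is assumed to be the only rational root of x^4+Ax+B counted with multiplicity; otherwise it fails, e.g. x^8-32x^2+48 with v=2 has quotient (x^2-2)(x^4+4x^2+12). The equivalence with the parametrisation needs no such assumption. -}

module Defs where

open import Agda.Builtin.FromNat using (Number; fromNat)
open import Algebra.Bundles.Raw using (RawSemiring)
import Algebra.Definitions.RawSemiring as RawSemiringDefinitions
import Data.Integer as ℤ
open import Data.List using (List; []; _∷_; map; foldr)
open import Data.List.Relation.Binary.Pointwise using (Pointwise)
open import Data.List.Relation.Unary.Sorted.TotalOrder using (Sorted)
open import Data.Nat as ℕ using (ℕ; zero; suc)
import Data.Nat.Literals as ℕLiterals
import Data.Nat.Properties as ℕ
open import Data.Product using (_×_; _,_; ∃-syntax)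
open import Data.Rational
  using (ℚ; 0ℚ; 1ℚ; _+_; _*_; _-_; -_; _/_; +-*-rawSemiring)
import Data.Rational.Literals as ℚLiterals
open import Data.Unit using (⊤; tt)
open import Level using (0ℓ)
open import Relation.Binary.PropositionalEquality using (_≡_; _≢_)
open import Relation.Nullary using (¬_)

private instance
  numberℕ : Number ℕ
  numberℕ = ℕLiterals.number

  numberℚ : Number ℚ
  numberℚ = ℚLiterals.number

open RawSemiringDefinitions +-*-rawSemiring using (_^_)

------------------------------------------------------------------------
-- The polynomial ring ℚ[x]

-- Coefficient lists, constant term first. Trailing zeros are allowed, so
-- equality of polynomials is _≈_ below, not _≡_.
Poly : Set
Poly = List ℚ

coeff : Poly → ℕ → ℚ
coeff []      _       = 0ℚ
coeff (a ∷ p) zero    = a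
coeff (a ∷ p) (suc n) = coeff p n

infix  4 _≈_
infixl 6 _⊕_
infixl 7 _⊛_

_≈_ : Poly → Poly → Set
p ≈ q = ∀ n → coeff p n ≡ coeff q n

_⊕_ : Poly → Poly → Poly
[]      ⊕ q       = q
(a ∷ p) ⊕ []      = a ∷ p
(a ∷ p) ⊕ (b ∷ q) = (a + b) ∷ (p ⊕ q)

_⊛_ : Poly → Poly → Poly
[]      ⊛ q = []
(a ∷ p) ⊛ q = map (a *_) q ⊕ (0ℚ ∷ (p ⊛ q))

ℚ[x]-rawSemiring : RawSemiring 0ℓ 0ℓ
ℚ[x]-rawSemiring = record
  { Carrier = Poly
  ; _≈_     = _≈_
  ; _+_     = _⊕_
  ; _*_     = _⊛_
  ; 0#      = []
  ; 1#      = 1ℚ ∷ []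
  }

open RawSemiring ℚ[x]-rawSemiring public using (0#; 1#)
open RawSemiringDefinitions ℚ[x]-rawSemiring public
  using (_∣_; _∤_; Irreducible)

eval : Poly → ℚ → ℚ
eval []      x = 0ℚ
eval (a ∷ p) x = a + x * eval p x

IsRoot : Poly → ℚ → Set
IsRoot p v = eval p v ≡ 0ℚ

HasDegree : Poly → ℕ → Set
HasDegree p n = coeff p n ≢ 0ℚ × (∀ m → n ℕ.< m → coeff p m ≡ 0ℚ)

Monic : Poly → Set
Monic p = ∃[ n ] (HasDegree p n × coeff p n ≡ 1ℚ)

-- f ∤ 1# says that f is not a unit. This is a witnessed factorisation,
-- rather than the negation of Irreducible.
Reducible : Poly → Set
Reducible p =
  ¬ (p ≈ 0#) × ∃[ f ] ∃[ g ] (p ≈ f ⊛ g × f ∤ 1# × g ∤ 1#)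

HasReducibilityType : Poly → List ℕ → Set
HasReducibilityType p ns =
  Monic p ×
  Sorted ℕ.≤-totalOrder ns ×
  ∃[ fs ] (p ≈ foldr _⊛_ 1# fs ×
           Pointwise (λ f n → Irreducible f × HasDegree f n) fs ns)

-- v is the only rational root, counted with multiplicity: once the
-- factor x - v is removed, no rational root is left. (With a second root
-- w, x² - w divides the quotient by x² - v, as for x⁸ - 15 x² + 14 =
-- (x² - 1)(x² - 2)(x⁴ + 3 x² + 7), so its type is not (3,3).)
IsSoleRoot : Poly → ℚ → Set
IsSoleRoot p v =
  IsRoot p v ×
  (∀ c → p ≈ (- v ∷ 1ℚ ∷ []) ⊛ c → ∀ w → ¬ IsRoot c w)

------------------------------------------------------------------------
-- The trinomials

-- x⁴ + A x + B
quartic : ℚ → ℚ → Poly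
quartic A B = B ∷ A ∷ 0 ∷ 0 ∷ 1 ∷ []

-- x⁸ + A x² + B
octic : ℚ → ℚ → Poly
octic A B = B ∷ 0 ∷ A ∷ 0 ∷ 0 ∷ 0 ∷ 0 ∷ 0 ∷ 1 ∷ []

-- g = (x⁸ + A x² + B) / (x² - v)
IsQuotient : ℚ → ℚ → ℚ → Poly → Set
IsQuotient A B v g = octic A B ≈ (- v ∷ 0 ∷ 1 ∷ []) ⊛ g

EqualUpToScaling : ℚ × ℚ → ℚ × ℚ → Set
EqualUpToScaling (A , B) (A′ , B′) =
  ∃[ t ] (t ≢ 0ℚ × A ≡ A′ * t ^ 6 × B ≡ B′ * t ^ 8)

¼ ⅓ : ℚ
¼ = ℤ.+ 1 / 4
⅓ = ℤ.+ 1 / 3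

A⟨_⟩ B⟨_⟩ : ℚ → ℚ
A⟨ q ⟩ = - ((q ^ 2 + 2 * q - 1) * (9 * q ^ 2 - 10 * q + 3) * ¼)
B⟨ q ⟩ = (q - 1) ^ 2 * (2 * q - 1) * (3 * q - 1) ^ 2 * ¼

{-# OPTIONS --safe #-}
module Submission where

-- Put c = v³ + A. The quotient is g(x) = h(x²) with h(y) = y³ + v y² + v² y + c, and h has no rational root
-- when v is the sole root of the quartic. A linear or quadratic factor of g would produce a rational root of h,
-- so a reducible g is a product of two cubics without rational roots.
--
-- If g is a product of two irreducible monic cubics, comparing coefficients shows that they are
-- x³ + a x² + b x + d and x³ - a x² + b x - d, with v = 2 b - a², c = - d² and 2 a d = b² - v². As v ≠ 0, also
-- a ≠ 0, and q = b / a² together with the scaling factor t = a gives the parametrisation.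
--
-- Conversely, parameters q and t give such a factorisation for v = (2 q - 1) t². A rational root of a cubic factor
-- would be a rational point on Y² = Z³ - 2 Z² + 9 Z other than those with q ∈ {1, 1/2, 1/3}. Doubling a point of
-- this curve gives rational s and u with s² + u² and s² + 3 u² both squares, and u = 0 by Fermat descent. The
-- irreducibility of the cubics also excludes a second rational root of the quartic, so v = (2 q - 1) t².

-- Arithmetic of natural numbers for the descent.

module ConcordantForms where

  open import Data.Nat
  open import Data.Nat.Properties
  open import Data.Nat.Divisibility
  open import Data.Nat.DivMod using (m*[n/m]≡n)
  open import Data.Nat.GCD
  open import Data.Nat.Coprimality as Coprimality using (Coprime; coprime-divisor; coprime-/gcd)
  open import Data.Nat.Induction using (<-rec)
  open import Data.Nat.Tactic.RingSolver using (solve-∀)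
  open import Data.Product using (_×_; _,_; ∃-syntax)
  open import Data.Sum using (_⊎_; inj₁; inj₂)
  open import Data.Empty using (⊥; ⊥-elim)
  open import Function using (_∘_)
  open import Relation.Nullary using (yes; no)
  open import Relation.Binary.PropositionalEquality

  coprime-*ˡ : ∀ {a b c} → Coprime a c → Coprime b c → Coprime (a * b) c
  coprime-*ˡ a⊥c b⊥c (d∣ab , d∣c) =
    b⊥c (coprime-divisor (λ (e∣d , e∣a) → a⊥c (e∣a , ∣-trans e∣d d∣c)) d∣ab , d∣c)

  coprime-∣ : ∀ {a b c d} → Coprime a b → c ∣ a → d ∣ b → Coprime c d
  coprime-∣ a⊥b c∣a d∣b (e∣c , e∣d) = a⊥b (∣-trans e∣c c∣a , ∣-trans e∣d d∣b)

  coprime-∣+ : ∀ {a b c} → Coprime a b → a ∣ c → Coprime a (c + b)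
  coprime-∣+ a⊥b a∣c (d∣a , d∣c+b) = a⊥b (d∣a , ∣m+n∣m⇒∣n d∣c+b (∣-trans d∣a a∣c))

  gcd-split : ∀ m n → m ≢ 0 →
    ∃[ g ] ∃[ m′ ] ∃[ n′ ] (m ≡ g * m′ × n ≡ g * n′ × Coprime m′ n′)
  gcd-split m n m≢0 =
    gcd m n , _ , _ , sym (quotient-eq m (gcd[m,n]∣m m n)) , sym (quotient-eq n (gcd[m,n]∣n m n)) ,
    coprime-/gcd m n
    where
    instance
      gcd-nonZero : NonZero (gcd m n)
      gcd-nonZero = ≢-nonZero (m≢0 ∘ gcd[m,n]≡0⇒m≡0)
    quotient-eq : ∀ k → gcd m n ∣ k → gcd m n * (k / gcd m n) ≡ k
    quotient-eq k g∣k = m*[n/m]≡n g∣k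

  factor≢0ˡ : ∀ {m n} → m * n ≢ 0 → m ≢ 0
  factor≢0ˡ mn≢0 refl = mn≢0 refl

  factor≢0ʳ : ∀ m {n} → m * n ≢ 0 → n ≢ 0
  factor≢0ʳ m mn≢0 refl = mn≢0 (*-zeroʳ m)

  *-≢0 : ∀ {m n} → m ≢ 0 → n ≢ 0 → m * n ≢ 0
  *-≢0 {m} m≢0 n≢0 mn≡0 with m*n≡0⇒m≡0∨n≡0 m mn≡0
  ... | inj₁ m≡0 = m≢0 m≡0
  ... | inj₂ n≡0 = n≢0 n≡0

  cancelˡ : ∀ {m n} k → k ≢ 0 → k * m ≡ k * n → m ≡ n
  cancelˡ k k≢0 eq = *-cancelˡ-≡ _ _ k {{≢-nonZero k≢0}} eq

  -- Euler's four-number lemma. With α = gcd(a, c), cancelling α from a b = c d leaves β b = γ d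
  -- with β and γ coprime, so β divides d.
  four-number : ∀ {a b c d} → a ≢ 0 → a * b ≡ c * d →
    ∃[ α ] ∃[ β ] ∃[ γ ] ∃[ δ ] (a ≡ α * β × b ≡ γ * δ × c ≡ α * γ × d ≡ β * δ)
  four-number {a} {b} {c} {d} a≢0 ab≡cd with gcd-split a c a≢0
  ... | α , β , γ , refl , refl , β⊥γ with coprime-divisor β⊥γ β∣γd
    where
    βb≡γd : β * b ≡ γ * d
    βb≡γd = cancelˡ α (factor≢0ˡ a≢0)
      (trans (sym (*-assoc α β b)) (trans ab≡cd (*-assoc α γ d)))
    β∣γd : β ∣ γ * d
    β∣γd = divides b (trans (sym βb≡γd) (*-comm β b))
  ... | divides δ refl = α , β , γ , δ , refl , b≡γδ , refl , *-comm δ β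
    where
    eq : ∀ α β γ δ → (α * γ) * (δ * β) ≡ (α * β) * (γ * δ)
    eq = solve-∀
    b≡γδ : b ≡ γ * δ
    b≡γδ = cancelˡ (α * β) a≢0 (trans ab≡cd (eq α β γ δ))

  -- `four-number` gives a = α β, b = γ δ and c = α γ = β δ. Coprimality of a and b makes α coprime
  -- to δ and β coprime to γ, so α and β divide each other, and then γ = δ.
  coprime-square : ∀ {a b c} → a ≢ 0 → Coprime a b → a * b ≡ c * c →
    ∃[ x ] ∃[ y ] (a ≡ x * x × b ≡ y * y × c ≡ x * y)
  coprime-square {a} {b} {c} a≢0 a⊥b ab≡cc with four-number {a} {b} {c} {c} a≢0 ab≡cc
  ... | α , β , γ , δ , refl , refl , refl , αγ≡βδ with ∣-antisym α∣β β∣α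
    where
    α∣β : α ∣ β
    α∣β = coprime-divisor {n = δ} (coprime-∣ a⊥b (m∣m*n β) (n∣m*n γ))
            (divides γ (trans (*-comm δ β) (trans (sym αγ≡βδ) (*-comm α γ))))
    β∣α : β ∣ α
    β∣α = coprime-divisor {n = γ} (coprime-∣ a⊥b (n∣m*n α) (m∣m*n δ))
            (divides δ (trans (*-comm γ α) (trans αγ≡βδ (*-comm β δ))))
  ... | refl = α , γ , refl , cong (γ *_) (sym γ≡δ) , refl
    where
    γ≡δ : γ ≡ δ
    γ≡δ = cancelˡ α (factor≢0ˡ a≢0) αγ≡βδ

  -- Dividing by e = gcd(d, p) leaves coprime d′ and p′ with d′² ∣ p′². Hence d′ ∣ p′ and d′ = 1.
  square-∣ : ∀ {d p} → d ≢ 0 → d * d ∣ p * p → d ∣ p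
  square-∣ {d} {p} d≢0 dd∣pp with gcd-split d p d≢0
  ... | e , d′ , p′ , refl , refl , d′⊥p′ = subst (λ z → e * z ∣ e * p′) (sym d′≡1)
    (*-monoʳ-∣ e (1∣ p′))
    where
    eq : ∀ e d → (e * d) * (e * d) ≡ (e * e) * (d * d)
    eq = solve-∀
    e≢0 : e ≢ 0
    e≢0 = factor≢0ˡ d≢0
    d′d′∣p′p′ : d′ * d′ ∣ p′ * p′
    d′d′∣p′p′ = *-cancelˡ-∣ (e * e) {{≢-nonZero (*-≢0 e≢0 e≢0)}} (subst₂ _∣_ (eq e d′) (eq e p′) dd∣pp)
    d′∣p′ : d′ ∣ p′
    d′∣p′ = coprime-divisor d′⊥p′ (∣-trans (m∣m*n d′) d′d′∣p′p′)
    d′≡1 : d′ ≡ 1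
    d′≡1 = d′⊥p′ (∣-refl , d′∣p′)

  -- Parity and squares modulo 4.

  even-or-odd : ∀ n → (∃[ k ] n ≡ 2 * k) ⊎ (∃[ k ] n ≡ suc (2 * k))
  even-or-odd zero = inj₁ (0 , refl)
  even-or-odd (suc n) with even-or-odd n
  ... | inj₁ (k , eq) = inj₂ (k , cong suc eq)
  ... | inj₂ (k , refl) = inj₁ (suc k , sym (*-suc 2 k))

  square≢2+4k : ∀ n k → n * n ≢ 2 + 4 * k
  square≢2+4k n k eq with even-or-odd n
  ... | inj₁ (j , refl) = even≢odd (j * j) k (*-cancelˡ-≡ _ _ 2 (trans (l j) (trans eq (r k))))
    where
    l : ∀ j → 2 * (2 * (j * j)) ≡ 2 * j * (2 * j)
    l = solve-∀
    r : ∀ k → 2 + 4 * k ≡ 2 * (1 + 2 * k)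
    r = solve-∀
  ... | inj₂ (j , refl) = even≢odd (1 + 2 * k) (2 * (j * j + j)) (trans (l k) (trans (sym eq) (r j)))
    where
    l : ∀ k → 2 * (1 + 2 * k) ≡ 2 + 4 * k
    l = solve-∀
    r : ∀ j → (1 + 2 * j) * (1 + 2 * j) ≡ 1 + 2 * (2 * (j * j + j))
    r = solve-∀

  square≢3+4k : ∀ n k → n * n ≢ 3 + 4 * k
  square≢3+4k n k eq with even-or-odd n
  ... | inj₁ (j , refl) = even≢odd (2 * (j * j)) (1 + 2 * k) (trans (l j) (trans eq (r k)))
    where
    l : ∀ j → 2 * (2 * (j * j)) ≡ 2 * j * (2 * j)
    l = solve-∀
    r : ∀ k → 3 + 4 * k ≡ 1 + 2 * (1 + 2 * k)
    r = solve-∀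
  ... | inj₂ (j , refl) = even≢odd (j * j + j) k (*-cancelˡ-≡ _ _ 2 (suc-injective (trans (l j) (trans eq (r k)))))
    where
    l : ∀ j → 1 + 2 * (2 * (j * j + j)) ≡ (1 + 2 * j) * (1 + 2 * j)
    l = solve-∀
    r : ∀ k → 3 + 4 * k ≡ 1 + 2 * (1 + 2 * k)
    r = solve-∀

  square-cancel-≤ : ∀ {x y} → x * x ≤ y * y → x ≤ y
  square-cancel-≤ xx≤yy = ≮⇒≥ λ y<x → <⇒≱ (*-mono-< y<x y<x) xx≤yy

  -- An odd difference y - x would make y² - x² odd, so y = x + 2 u, and y² - x² = 4 u (u + x).
  square-difference : ∀ {x y w} → x * x + 4 * w ≡ y * y →
    ∃[ u ] (y ≡ x + 2 * u × u * (u + x) ≡ w)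
  square-difference {x} {y} {w} eq with m≤n⇒∃[o]m+o≡n (square-cancel-≤ {x} {y} (subst (x * x ≤_) eq (m≤m+n _ _)))
  ... | e , refl with even-or-odd e | 4w≡
    where
    expand : ∀ x e → (x + e) * (x + e) ≡ x * x + (2 * (x * e) + e * e)
    expand = solve-∀
    4w≡ : 4 * w ≡ 2 * (x * e) + e * e
    4w≡ = +-cancelˡ-≡ (x * x) _ _ (trans eq (expand x e))
  ... | inj₁ (u , refl) | 4w≡ = u , refl , *-cancelˡ-≡ _ _ 4 (trans (l x u) (sym 4w≡))
    where
    l : ∀ x u → 4 * (u * (u + x)) ≡ 2 * (x * (2 * u)) + 2 * u * (2 * u)
    l = solve-∀
  ... | inj₂ (u , refl) | 4w≡ =
    ⊥-elim (even≢odd (2 * w) (x * suc (2 * u) + 2 * (u * u + u)) (trans (l w) (trans 4w≡ (r x u))))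
    where
    l : ∀ w → 2 * (2 * w) ≡ 4 * w
    l = solve-∀
    r : ∀ x u → 2 * (x * (1 + 2 * u)) + (1 + 2 * u) * (1 + 2 * u) ≡ 1 + 2 * (x * (1 + 2 * u) + 2 * (u * u + u))
    r = solve-∀

  -- Fermat descent on Euler's concordant forms s² + q² and s² + 3 q².

  Concordant : ℕ → Set
  Concordant q = ∃[ s ] ∃[ p ] ∃[ r ] (s * s + q * q ≡ p * p × s * s + 3 * (q * q) ≡ r * r)

  -- The square of g = gcd(q, s) divides p² and r², so g divides p and r and can be cancelled
  -- throughout.
  make-coprime : ∀ {s q p r} → q ≢ 0 → s * s + q * q ≡ p * p → s * s + 3 * (q * q) ≡ r * r →
    ∃[ s′ ] ∃[ q′ ] ∃[ p′ ] ∃[ r′ ] (q′ ≢ 0 × q′ ≤ q × Coprime q′ s′ ×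
      s′ * s′ + q′ * q′ ≡ p′ * p′ × s′ * s′ + 3 * (q′ * q′) ≡ r′ * r′)
  make-coprime {s} {q} {p} {r} q≢0 eqp eqr with gcd-split q s q≢0
  ... | g , q′ , s′ , refl , refl , q′⊥s′
    with square-∣ {g} {p} g≢0 (divides (s′ * s′ + q′ * q′) (trans (sym eqp) (ep g s′ q′)))
       | square-∣ {g} {r} g≢0 (divides (s′ * s′ + 3 * (q′ * q′)) (trans (sym eqr) (er g s′ q′)))
    where
    g≢0 : g ≢ 0
    g≢0 = factor≢0ˡ q≢0
    ep : ∀ g s q → g * s * (g * s) + g * q * (g * q) ≡ (s * s + q * q) * (g * g)
    ep = solve-∀
    er : ∀ g s q → g * s * (g * s) + 3 * (g * q * (g * q)) ≡ (s * s + 3 * (q * q)) * (g * g)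
    er = solve-∀
  ... | divides p′ refl | divides r′ refl =
    s′ , q′ , p′ , r′ , factor≢0ʳ g q≢0 , m≤n*m q′ g {{≢-nonZero g≢0}} , q′⊥s′ ,
    cancelˡ (g * g) (*-≢0 g≢0 g≢0) (trans (ep g s′ q′) (trans eqp (rhs p′ g))) ,
    cancelˡ (g * g) (*-≢0 g≢0 g≢0) (trans (er g s′ q′) (trans eqr (rhs r′ g)))
    where
    g≢0 : g ≢ 0
    g≢0 = factor≢0ˡ q≢0
    ep : ∀ g s q → g * g * (s * s + q * q) ≡ g * s * (g * s) + g * q * (g * q)
    ep = solve-∀
    er : ∀ g s q → g * g * (s * s + 3 * (q * q)) ≡ g * s * (g * s) + 3 * (g * q * (g * q))
    er = solve-∀
    rhs : ∀ p g → p * g * (p * g) ≡ g * g * (p * p)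
    rhs = solve-∀

  -- Modulo 4 only even q = 2 k and odd s survive. Then p = s + 2 u with u (u + s) = k², and the
  -- coprime factors are u = n² and u + s = m². The last equation is r² = p² + 2 q², written in the
  -- shape that `square-difference` takes.
  pythagorean-parametrisation : ∀ {s q p r} → q ≢ 0 → Coprime q s →
    s * s + q * q ≡ p * p → s * s + 3 * (q * q) ≡ r * r →
    ∃[ m ] ∃[ n ] ∃[ j ] (q ≡ 2 * (m * n) × p ≡ m * m + n * n × p ≡ suc (2 * j) × Coprime m n ×
      p * p + 4 * (2 * (m * n * (m * n))) ≡ r * r)
  pythagorean-parametrisation {s} {q} {p} {r} q≢0 q⊥s eqp eqr with even-or-odd q | even-or-odd s
  ... | inj₂ (k , refl) | inj₁ (j , refl) = ⊥-elim
    (square≢3+4k r (j * j + 3 * k + 3 * (k * k)) (trans (sym eqr) (e j k)))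
    where
    e : ∀ j k → 2 * j * (2 * j) + 3 * ((1 + 2 * k) * (1 + 2 * k)) ≡ 3 + 4 * (j * j + 3 * k + 3 * (k * k))
    e = solve-∀
  ... | inj₂ (k , refl) | inj₂ (j , refl) = ⊥-elim
    (square≢2+4k p (j * j + j + k + k * k) (trans (sym eqp) (e j k)))
    where
    e : ∀ j k → (1 + 2 * j) * (1 + 2 * j) + (1 + 2 * k) * (1 + 2 * k) ≡ 2 + 4 * (j * j + j + k + k * k)
    e = solve-∀
  ... | inj₁ (k , refl) | inj₁ (j , refl) with () ← q⊥s (m∣m*n {2} k , m∣m*n {2} j)
  ... | inj₁ (k , refl) | inj₂ (j , refl) with square-difference {s} {p} {k * k} (trans (e s k) eqp)
    where
    e : ∀ s k → s * s + 4 * (k * k) ≡ s * s + 2 * k * (2 * k)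
    e = solve-∀
  ... | u , refl , u[u+s]≡kk with coprime-square {u} {u + s} {k} u≢0 u⊥u+s u[u+s]≡kk
    where
    k≢0 : k ≢ 0
    k≢0 = factor≢0ʳ 2 q≢0
    u≢0 : u ≢ 0
    u≢0 refl = *-≢0 k≢0 k≢0 (sym u[u+s]≡kk)
    k⊥s : Coprime k s
    k⊥s = coprime-∣ q⊥s (n∣m*n 2) ∣-refl
    u⊥s : Coprime u s
    u⊥s = coprime-∣ (coprime-*ˡ k⊥s k⊥s) (subst (u ∣_) u[u+s]≡kk (m∣m*n _)) ∣-refl
    u⊥u+s : Coprime u (u + s)
    u⊥u+s = coprime-∣+ u⊥s ∣-refl
  ... | n , m , refl , nn+s≡mm , refl = m , n , j + n * n , cong (2 *_) (*-comm n m) , p≡ , cong suc (odd j n) , m⊥n ,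
    trans (cong (_+ 4 * (2 * (m * n * (m * n)))) (sym eqp)) (trans (eq m n s) eqr)
    where
    p≡ : s + 2 * (n * n) ≡ m * m + n * n
    p≡ = trans (e s n) (cong (_+ n * n) nn+s≡mm)
      where
      e : ∀ s n → s + 2 * (n * n) ≡ n * n + s + n * n
      e = solve-∀
    odd : ∀ j n → 2 * j + 2 * (n * n) ≡ 2 * (j + n * n)
    odd = solve-∀
    n⊥s : Coprime n s
    n⊥s = coprime-∣ q⊥s (∣-trans (m∣m*n m) (n∣m*n 2)) ∣-refl
    m⊥n : Coprime m n
    m⊥n {d} (d∣m , d∣n) = n⊥s (d∣n ,
      ∣m+n∣m⇒∣n (subst (d ∣_) (sym nn+s≡mm) (∣m⇒∣m*n m d∣m)) (∣m⇒∣m*n n d∣n))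
    eq : ∀ m n s → s * s + 2 * (n * m) * (2 * (n * m)) + 4 * (2 * (m * n * (m * n))) ≡
      s * s + 3 * (2 * (n * m) * (2 * (n * m)))
    eq = solve-∀

  -- For even b the left side is divisible by 8 while the right side is 2 modulo 4. For odd b the
  -- product (1 + 2 i) b is odd, yet it equals an even number.
  2b²≢a²+[2k]²+[1+2l]² : ∀ {b i k l} → 2 * k * suc (2 * l) ≡ suc (2 * i) * b →
    2 * (b * b) ≢ suc (2 * i) * suc (2 * i) + (2 * k * (2 * k) + suc (2 * l) * suc (2 * l))
  2b²≢a²+[2k]²+[1+2l]² {b} {i} {k} {l} mn≡ab eq with even-or-odd b
  ... | inj₁ (j , refl) = even≢odd (2 * (j * j)) (i + i * i + k * k + l + l * l)
    (*-cancelˡ-≡ _ _ 2 (trans (e j) (trans eq (e′ i k l))))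
    where
    e : ∀ j → 2 * (2 * (2 * (j * j))) ≡ 2 * (2 * j * (2 * j))
    e = solve-∀
    e′ : ∀ i k l → (1 + 2 * i) * (1 + 2 * i) + (2 * k * (2 * k) + (1 + 2 * l) * (1 + 2 * l)) ≡
           2 * (1 + 2 * (i + i * i + k * k + l + l * l))
    e′ = solve-∀
  ... | inj₂ (j , refl) = even≢odd (k * suc (2 * l)) (i + j + 2 * (i * j))
    (trans (sym (*-assoc 2 k _)) (trans mn≡ab (e i j)))
    where
    e : ∀ i j → (1 + 2 * i) * (1 + 2 * j) ≡ 1 + 2 * (i + j + 2 * (i * j))
    e = solve-∀

  -- An odd m² + n² forces m and n to have opposite parity; the two possibilities differ by a swap.
  2b²≢a²+m²+n² : ∀ {a b m n i j} → m * n ≡ a * b → a ≡ suc (2 * i) → m * m + n * n ≡ suc (2 * j) →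
    2 * (b * b) ≢ a * a + (m * m + n * n)
  2b²≢a²+m²+n² {b = b} {m} {n} {i} {j} mn≡ab refl odd eq with even-or-odd m | even-or-odd n
  ... | inj₁ (k , refl) | inj₁ (l , refl) = even≢odd (2 * (k * k + l * l)) j (trans (e k l) odd)
    where
    e : ∀ k l → 2 * (2 * (k * k + l * l)) ≡ 2 * k * (2 * k) + 2 * l * (2 * l)
    e = solve-∀
  ... | inj₂ (k , refl) | inj₂ (l , refl) = even≢odd (1 + 2 * (k * k + k + l * l + l)) j (trans (e k l) odd)
    where
    e : ∀ k l → 2 * (1 + 2 * (k * k + k + l * l + l)) ≡ (1 + 2 * k) * (1 + 2 * k) + (1 + 2 * l) * (1 + 2 * l)
    e = solve-∀
  ... | inj₁ (k , refl) | inj₂ (l , refl) = 2b²≢a²+[2k]²+[1+2l]² {b} {i} {k} {l} mn≡ab eq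
  ... | inj₂ (l , refl) | inj₁ (k , refl) = 2b²≢a²+[2k]²+[1+2l]² {b} {i} {k} {l} (trans (*-comm (2 * k) _) mn≡ab)
    (trans eq (cong (suc (2 * i) * suc (2 * i) +_) (+-comm (suc (2 * l) * suc (2 * l)) _)))

  -- Writing a = αβ, b = γδ, m = αγ, n = βδ, the equation becomes γ² (δ² - α²) = β² (δ² + 2α²), so that
  -- δ² + 2α² = kγ² and δ² - α² = kβ² with k ∣ 3. The pair (s , q) is (β , α) for k = 1 and (α , β) for k = 3.
  descend-through-factors : ∀ {a b m n} → a * b ≡ m * n → a * b ≢ 0 → Coprime a b → Coprime m n →
    2 * (a * a) + (m * m + n * n) ≡ b * b → ∃[ q ] (q ≢ 0 × q < 2 * (m * n) × Concordant q)
  descend-through-factors {a} {b} {m} {n} ab≡mn ab≢0 a⊥b m⊥n eq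
    with four-number {a} {b} {m} {n} (factor≢0ˡ ab≢0) ab≡mn
  ... | α , β , γ , δ , refl , refl , refl , refl
    with coprime-divisor {γ * γ} {β * β} {δ * δ + 2 * (α * α)} γγ⊥ββ
           (∣m+n∣m⇒∣n {m = γ * γ * (α * α)} (divides (δ * δ) (trans (e α β γ δ) (trans eq (e′ γ δ)))) (m∣m*n (α * α)))
    where
    e : ∀ α β γ δ → γ * γ * (α * α) + β * β * (δ * δ + 2 * (α * α)) ≡
          2 * (α * β * (α * β)) + (α * γ * (α * γ) + β * δ * (β * δ))
    e = solve-∀
    e′ : ∀ γ δ → γ * δ * (γ * δ) ≡ δ * δ * (γ * γ)
    e′ = solve-∀
    γ⊥β : Coprime γ β
    γ⊥β = coprime-∣ m⊥n (n∣m*n α) (m∣m*n δ)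
    γ⊥ββ : Coprime γ (β * β)
    γ⊥ββ = Coprimality.sym (coprime-*ˡ (Coprimality.sym γ⊥β) (Coprimality.sym γ⊥β))
    γγ⊥ββ : Coprime (γ * γ) (β * β)
    γγ⊥ββ = coprime-*ˡ γ⊥ββ γ⊥ββ
  ... | divides k δδ+2αα≡kγγ = conclude k∣3 refl
    where
    α≢0 : α ≢ 0
    α≢0 = factor≢0ˡ (factor≢0ˡ ab≢0)
    β≢0 : β ≢ 0
    β≢0 = factor≢0ʳ α (factor≢0ˡ ab≢0)
    γ≢0 : γ ≢ 0
    γ≢0 = factor≢0ˡ (factor≢0ʳ (α * β) ab≢0)
    δ≢0 : δ ≢ 0
    δ≢0 = factor≢0ʳ γ (factor≢0ʳ (α * β) ab≢0)

    kββ+αα≡δδ : k * (β * β) + α * α ≡ δ * δ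
    kββ+αα≡δδ = cancelˡ (γ * γ) (*-≢0 γ≢0 γ≢0) (begin
      γ * γ * (k * (β * β) + α * α)                                      ≡⟨ e₁ α β γ k ⟩
      β * β * (k * (γ * γ)) + α * γ * (α * γ)
        ≡⟨ cong (λ z → β * β * z + α * γ * (α * γ)) (sym δδ+2αα≡kγγ) ⟩
      β * β * (δ * δ + 2 * (α * α)) + α * γ * (α * γ)                    ≡⟨ e₂ α β γ δ ⟩
      2 * (α * β * (α * β)) + (α * γ * (α * γ) + β * δ * (β * δ))        ≡⟨ eq ⟩
      γ * δ * (γ * δ)                                                    ≡⟨ e₃ γ δ ⟩
      γ * γ * (δ * δ)                                                    ∎)
      where
      open ≡-Reasoning
      e₁ : ∀ α β γ k → γ * γ * (k * (β * β) + α * α) ≡ β * β * (k * (γ * γ)) + α * γ * (α * γ)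
      e₁ = solve-∀
      e₂ : ∀ α β γ δ → β * β * (δ * δ + 2 * (α * α)) + α * γ * (α * γ) ≡
             2 * (α * β * (α * β)) + (α * γ * (α * γ) + β * δ * (β * δ))
      e₂ = solve-∀
      e₃ : ∀ γ δ → γ * δ * (γ * δ) ≡ γ * γ * (δ * δ)
      e₃ = solve-∀

    kββ+3αα≡kγγ : k * (β * β) + α * α * 3 ≡ k * (γ * γ)
    kββ+3αα≡kγγ = trans (e k α β) (trans (cong (_+ 2 * (α * α)) kββ+αα≡δδ) δδ+2αα≡kγγ)
      where
      e : ∀ k α β → k * (β * β) + α * α * 3 ≡ k * (β * β) + α * α + 2 * (α * α)
      e = solve-∀

    α⊥δ : Coprime α δ
    α⊥δ = coprime-∣ m⊥n (m∣m*n γ) (n∣m*n β)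
    α⊥k : Coprime α k
    α⊥k {d} (d∣α , d∣k) = coprime-*ˡ (Coprimality.sym α⊥δ) (Coprimality.sym α⊥δ)
      (subst (d ∣_) kββ+αα≡δδ (∣m∣n⇒∣m+n (∣m⇒∣m*n (β * β) d∣k) (∣m⇒∣m*n α d∣α)) , d∣α)
    -- k divides 3 α² and is coprime to α: a common divisor of k and α divides δ², and α is coprime
    -- to δ.
    k∣3 : k ∣ 3
    k∣3 = coprime-divisor (Coprimality.sym (coprime-*ˡ α⊥k α⊥k))
      (∣m+n∣m⇒∣n (subst (k ∣_) (sym kββ+3αα≡kγγ) (m∣m*n _)) (m∣m*n (β * β)))

    -- The new value α or β is a factor of the non-zero product m n = α γ β δ, hence smaller than
    -- the old value 2 m n.
    <-double-multiple : ∀ x y → x ≢ 0 → y ≢ 0 → x < 2 * (x * y)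
    <-double-multiple x y x≢0 y≢0 = <-≤-trans
      (m<m*n x 2 {{≢-nonZero x≢0}} ≤-refl)
      (≤-trans (m≤m*n (x * 2) y {{≢-nonZero y≢0}}) (≤-reflexive (e x y)))
      where
      e : ∀ x y → x * 2 * y ≡ 2 * (x * y)
      e = solve-∀

    conclude : ∀ {k′} → k′ ∣ 3 → k ≡ k′ → ∃[ q ] (q ≢ 0 × q < 2 * (α * γ * (β * δ)) × Concordant q)
    conclude {0} 0∣3 _ with () ← 0∣⇒≡0 0∣3
    conclude {1} _ refl = α , α≢0 ,
      subst (λ z → α < 2 * z) (e α β γ δ) (<-double-multiple α (γ * (β * δ)) α≢0 (*-≢0 γ≢0 (*-≢0 β≢0 δ≢0))) ,
      β , δ , γ , trans (e₁ α β) kββ+αα≡δδ , trans (e₂ α β) (trans kββ+3αα≡kγγ (+-identityʳ _))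
      where
      e : ∀ α β γ δ → α * (γ * (β * δ)) ≡ α * γ * (β * δ)
      e = solve-∀
      e₁ : ∀ α β → β * β + α * α ≡ 1 * (β * β) + α * α
      e₁ = solve-∀
      e₂ : ∀ α β → β * β + 3 * (α * α) ≡ 1 * (β * β) + α * α * 3
      e₂ = solve-∀
    conclude {2} (divides 0 ()) _
    conclude {2} (divides 1 ()) _
    conclude {2} (divides (suc (suc n)) ()) _
    conclude {3} _ refl = β , β≢0 ,
      subst (λ z → β < 2 * z) (e α β γ δ) (<-double-multiple β (α * (γ * δ)) β≢0 (*-≢0 α≢0 (*-≢0 γ≢0 δ≢0))) ,
      α , γ , δ , cancelˡ 3 (λ ()) (trans (e₁ α β) kββ+3αα≡kγγ) , trans (e₂ α β) kββ+αα≡δδ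
      where
      e : ∀ α β γ δ → β * (α * (γ * δ)) ≡ α * γ * (β * δ)
      e = solve-∀
      e₁ : ∀ α β → 3 * (α * α + β * β) ≡ 3 * (β * β) + α * α * 3
      e₁ = solve-∀
      e₂ : ∀ α β → α * α + 3 * (β * β) ≡ 3 * (β * β) + α * α
      e₂ = solve-∀
    conclude {suc (suc (suc (suc _)))} k∣3 _ with s≤s (s≤s (s≤s ())) ← ∣⇒≤ k∣3

  -- With w = m n and r = p + 2 u, the relation p² + 8 w² = r² becomes u (u + p) = 2 w². Here p = m²
  -- + n² is odd and coprime to m and n, so u and u + p are coprime and exactly one of them is even.
  -- Halving that one leaves coprime factors with product w², so both are squares.
  descent : ∀ {q} → q ≢ 0 → Concordant q → ∃[ q′ ] (q′ ≢ 0 × q′ < q × Concordant q′)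
  descent {q} q≢0 (s , p , r , eqp , eqr) with make-coprime {s} {q} {p} {r} q≢0 eqp eqr
  ... | s₁ , q₁ , p₁ , r₁ , q₁≢0 , q₁≤q , q₁⊥s₁ , eqp₁ , eqr₁
    with pythagorean-parametrisation {s₁} {q₁} {p₁} {r₁} q₁≢0 q₁⊥s₁ eqp₁ eqr₁
  ... | m , n , j , refl , refl , p≡odd , m⊥n , p²+8w²≡r²
    with square-difference {m * m + n * n} {r₁} {2 * (m * n * (m * n))} p²+8w²≡r²
  ... | u , refl , u[u+p]≡2ww with descend (even-or-odd u)
    where
    w p′ : ℕ
    w = m * n
    p′ = m * m + n * n
    w≢0 : w ≢ 0
    w≢0 = factor≢0ʳ 2 q₁≢0
    u≢0 : u ≢ 0
    u≢0 refl = *-≢0 {2} (λ ()) (*-≢0 w≢0 w≢0) (sym u[u+p]≡2ww)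
    m⊥p : Coprime m p′
    m⊥p = coprime-∣+ (Coprimality.sym (coprime-*ˡ (Coprimality.sym m⊥n) (Coprimality.sym m⊥n))) (m∣m*n m)
    n⊥p : Coprime n p′
    n⊥p = subst (Coprime n) (+-comm (n * n) (m * m)) (coprime-∣+ (Coprimality.sym (coprime-*ˡ m⊥n m⊥n)) (m∣m*n n))
    2⊥p : Coprime 2 p′
    2⊥p = subst (Coprime 2) (trans (+-comm (2 * j) 1) (sym p≡odd)) (coprime-∣+ (λ (_ , d∣1) → ∣1⇒≡1 d∣1) (m∣m*n j))
    u⊥p : Coprime u p′
    u⊥p = coprime-∣ (coprime-*ˡ 2⊥p (coprime-*ˡ (coprime-*ˡ m⊥p n⊥p) (coprime-*ˡ m⊥p n⊥p)))
      (subst (u ∣_) u[u+p]≡2ww (m∣m*n (u + p′))) ∣-refl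
    u⊥u+p : Coprime u (u + p′)
    u⊥u+p = coprime-∣+ u⊥p ∣-refl

    descend : (∃[ k ] u ≡ 2 * k) ⊎ (∃[ k ] u ≡ suc (2 * k)) → ∃[ q′ ] (q′ ≢ 0 × q′ < 2 * w × Concordant q′)
    -- Even u: u = 2 a² and u + p = b² with a b = m n, so 2 a² + m² + n² = b².
    descend (inj₁ (k , u≡2k)) = from-squares (coprime-square {k} {u + p′} {w}
      (λ { refl → u≢0 u≡2k }) k⊥u+p
      (*-cancelˡ-≡ _ _ 2 (trans (sym (*-assoc 2 k _)) (subst (λ z → z * (u + p′) ≡ 2 * (w * w)) u≡2k u[u+p]≡2ww))))
      where
      k∣u : k ∣ u
      k∣u = divides 2 u≡2k
      k⊥u+p : Coprime k (u + p′)
      k⊥u+p = coprime-∣ u⊥u+p k∣u ∣-refl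
      from-squares : ∃[ a ] ∃[ b ] (k ≡ a * a × u + p′ ≡ b * b × w ≡ a * b) →
        ∃[ q′ ] (q′ ≢ 0 × q′ < 2 * w × Concordant q′)
      from-squares (a , b , refl , u+p≡bb , w≡ab) = descend-through-factors {a} {b} {m} {n} (sym w≡ab)
        (λ ab≡0 → w≢0 (trans w≡ab ab≡0))
        (coprime-∣ k⊥u+p (m∣m*n a) (subst (b ∣_) (sym u+p≡bb) (m∣m*n b)))
        m⊥n
        (trans (cong (_+ p′) (sym u≡2k)) u+p≡bb)
    -- Odd u: u = a² and u + p = 2 b² would give 2 b² = a² + m² + n², against `2b²≢a²+m²+n²`.
    descend (inj₂ (k , u≡1+2k)) = ⊥-elim (from-squares (coprime-square {u} {suc (k + j)} {w}
      u≢0 (coprime-∣ u⊥u+p ∣-refl (divides 2 2b≡))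
      (*-cancelˡ-≡ _ _ 2 (trans (e u (suc (k + j))) (trans (cong (u *_) (sym 2b≡)) u[u+p]≡2ww)))))
      where
      2b≡ : u + p′ ≡ 2 * suc (k + j)
      2b≡ = trans (cong₂ _+_ u≡1+2k p≡odd) (e₁ k j)
        where
        e₁ : ∀ k j → (1 + 2 * k) + (1 + 2 * j) ≡ 2 * (1 + (k + j))
        e₁ = solve-∀
      e : ∀ u b → 2 * (u * b) ≡ u * (2 * b)
      e = solve-∀
      from-squares : ∃[ a ] ∃[ b ] (u ≡ a * a × suc (k + j) ≡ b * b × w ≡ a * b) → ⊥
      from-squares (a , b , u≡aa , b′≡bb , w≡ab) with even-or-odd a
      ... | inj₁ (i , refl) = even≢odd (2 * (i * i)) k (trans (e₂ i) (trans (sym u≡aa) u≡1+2k))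
        where
        e₂ : ∀ i → 2 * (2 * (i * i)) ≡ 2 * i * (2 * i)
        e₂ = solve-∀
      ... | inj₂ (i , a≡odd) = 2b²≢a²+m²+n² {a} {b} {m} {n} {i} {j} w≡ab a≡odd p≡odd
        (trans (cong (2 *_) (sym b′≡bb)) (trans (sym 2b≡) (cong (_+ p′) u≡aa)))
  ... | q′ , q′≢0 , q′<q₁ , conc = q′ , q′≢0 , <-≤-trans q′<q₁ q₁≤q , conc

  concordant⇒≡0 : ∀ q → Concordant q → q ≡ 0
  concordant⇒≡0 = <-rec (λ q → Concordant q → q ≡ 0) step
    where
    step : ∀ q → (∀ {q′} → q′ < q → Concordant q′ → q′ ≡ 0) → Concordant q → q ≡ 0
    step q rec conc with q ≟ 0
    ... | yes q≡0 = q≡0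
    ... | no q≢0 with descent q≢0 conc
    ...   | q′ , q′≢0 , q′<q , conc′ = ⊥-elim (q′≢0 (rec q′<q conc′))

open import Defs
open import Algebra.Bundles.Raw using (RawSemiring)
open import Algebra.Definitions.RawMagma (RawSemiring.*-rawMagma ℚ[x]-rawSemiring) using (_,_)
import Data.Integer as ℤ
import Data.Integer.Properties as ℤ
import Data.Integer.Tactic.RingSolver as ℤ
open import Data.Empty using (⊥-elim)
open import Data.List using ([]; _∷_; map; length; applyUpTo; _++_)
open import Data.List.Relation.Binary.Pointwise using ([]; _∷_)
open import Data.List.Relation.Unary.Linked using ([-]; _∷_)
open import Data.Nat as ℕ using (ℕ; zero; suc; z≤n; s≤s)
import Data.Nat.Divisibility as ℕ
import Data.Nat.Properties as ℕ
open import Data.Product using (_×_; _,_; ∃-syntax; proj₁)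
open import Data.Rational
  using (ℚ; 0ℚ; 1ℚ; ½; _+_; _*_; -_; _-_; 1/_; ↥_; ↧_; ↧ₙ_;
         NonZero; ≢-nonZero; Positive; NonNegative; nonNegative; nonPositive)
open import Data.Rational.Literals using (fromℤ)
open import Data.Rational.Properties
import Data.Rational.Unnormalised as ℚᵘ
import Data.Rational.Unnormalised.Properties as ℚᵘ
open import Data.Sum using (_⊎_; inj₁; inj₂; [_,_]′)
open import Function using (_∘_)
open import Function.Bundles using (_⇔_; mk⇔)
open import Level using (0ℓ)
open import Relation.Binary.Definitions using (tri<; tri≈; tri>)
open import Relation.Binary.PropositionalEquality
open import Relation.Nullary using (¬_; yes; no; contradiction)
open import Relation.Nullary.Decidable using (dec⇒maybe)
open import Tactic.RingSolver using (solve-∀)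
open import Tactic.RingSolver.Core.AlmostCommutativeRing using (AlmostCommutativeRing; fromCommutativeRing)
open import Algebra.Properties.Group +-0-group using () renaming (∙-cancelˡ to +-cancelˡ)
open ConcordantForms using (concordant⇒≡0) renaming (*-≢0 to ℕ*-≢0)

-- Equational reasoning in the field ℚ.

ℚ-ring : AlmostCommutativeRing 0ℓ 0ℓ
ℚ-ring = fromCommutativeRing +-*-commutativeRing λ x → dec⇒maybe (0ℚ ≟ x)

xy≡0⇒x≡0∨y≡0 : ∀ x y → x * y ≡ 0ℚ → x ≡ 0ℚ ⊎ y ≡ 0ℚ
xy≡0⇒x≡0∨y≡0 x y xy≡0 with x ≟ 0ℚ
... | yes x≡0 = inj₁ x≡0
... | no x≢0 = inj₂ (begin
  y                ≡⟨ *-identityˡ y ⟨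
  1ℚ * y           ≡⟨ cong (_* y) (*-inverseˡ x) ⟨
  1/ x * x * y     ≡⟨ *-assoc (1/ x) x y ⟩
  1/ x * (x * y)   ≡⟨ cong (1/ x *_) xy≡0 ⟩
  1/ x * 0ℚ        ≡⟨ *-zeroʳ (1/ x) ⟩
  0ℚ               ∎)
  where
  open ≡-Reasoning
  instance
    x-nonZero : NonZero x
    x-nonZero = ≢-nonZero x≢0

x*y≡0⇒x≡0 : ∀ x y → y ≢ 0ℚ → x * y ≡ 0ℚ → x ≡ 0ℚ
x*y≡0⇒x≡0 x y y≢0 xy≡0 with xy≡0⇒x≡0∨y≡0 x y xy≡0
... | inj₁ x≡0 = x≡0
... | inj₂ y≡0 = ⊥-elim (y≢0 y≡0)

square≡0⇒≡0 : ∀ x → x * x ≡ 0ℚ → x ≡ 0ℚ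
square≡0⇒≡0 x xx≡0 with xy≡0⇒x≡0∨y≡0 x x xx≡0
... | inj₁ x≡0 = x≡0
... | inj₂ x≡0 = x≡0

x-y≡0⇒x≡y : ∀ x y → x - y ≡ 0ℚ → x ≡ y
x-y≡0⇒x≡y x y x-y≡0 = begin
  x            ≡⟨ e x y ⟩
  x - y + y    ≡⟨ cong (_+ y) x-y≡0 ⟩
  0ℚ + y       ≡⟨ +-identityˡ y ⟩
  y            ∎
  where
  open ≡-Reasoning
  e : ∀ x y → x ≡ x - y + y
  e = solve-∀ ℚ-ring

scaled-difference : ∀ c {l r} → l ≡ r → c * (l - r) ≡ 0ℚ
scaled-difference c {l} refl = trans (cong (c *_) (+-inverseʳ l)) (*-zeroʳ c)

-- This and its two successors derive an equation from known ones by a certificate: the difference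
-- of its sides is written as a combination of the known differences with explicit cofactors, and
-- the ring solver checks that identity.
combine₁ : ∀ {a b} c {l r} → l ≡ r → a - b ≡ c * (l - r) → a ≡ b
combine₁ c l≡r e = x-y≡0⇒x≡y _ _ (trans e (scaled-difference c l≡r))

combine₂ : ∀ {a b} c₁ {l₁ r₁} → l₁ ≡ r₁ → ∀ c₂ {l₂ r₂} → l₂ ≡ r₂ →
  a - b ≡ c₁ * (l₁ - r₁) + c₂ * (l₂ - r₂) → a ≡ b
combine₂ c₁ eq₁ c₂ eq₂ e =
  x-y≡0⇒x≡y _ _ (trans e (cong₂ _+_ (scaled-difference c₁ eq₁) (scaled-difference c₂ eq₂)))

combine₃ : ∀ {a b} c₁ {l₁ r₁} → l₁ ≡ r₁ → ∀ c₂ {l₂ r₂} → l₂ ≡ r₂ → ∀ c₃ {l₃ r₃} → l₃ ≡ r₃ →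
  a - b ≡ c₁ * (l₁ - r₁) + c₂ * (l₂ - r₂) + c₃ * (l₃ - r₃) → a ≡ b
combine₃ c₁ eq₁ c₂ eq₂ c₃ eq₃ e =
  x-y≡0⇒x≡y _ _ (trans e
    (cong₂ _+_ (cong₂ _+_ (scaled-difference c₁ eq₁) (scaled-difference c₂ eq₂)) (scaled-difference c₃ eq₃)))

-- Polynomials over ℚ

≈-sym : ∀ p q → p ≈ q → q ≈ p
≈-sym p q p≈q n = sym (p≈q n)

≈-trans : ∀ p q r → p ≈ q → q ≈ r → p ≈ r
≈-trans p q r p≈q q≈r n = trans (p≈q n) (q≈r n)

coeff-⊕ : ∀ p q n → coeff (p ⊕ q) n ≡ coeff p n + coeff q n
coeff-⊕ []      q       n       = sym (+-identityˡ (coeff q n))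
coeff-⊕ (a ∷ p) []      n       = sym (+-identityʳ (coeff (a ∷ p) n))
coeff-⊕ (a ∷ p) (b ∷ q) zero    = refl
coeff-⊕ (a ∷ p) (b ∷ q) (suc n) = coeff-⊕ p q n

coeff-map : ∀ c p n → coeff (map (c *_) p) n ≡ c * coeff p n
coeff-map c []      n       = sym (*-zeroʳ c)
coeff-map c (a ∷ p) zero    = refl
coeff-map c (a ∷ p) (suc n) = coeff-map c p n

coeff-⊛-zero : ∀ a p q → coeff ((a ∷ p) ⊛ q) 0 ≡ a * coeff q 0
coeff-⊛-zero a p q = trans (coeff-⊕ (map (a *_) q) (0ℚ ∷ p ⊛ q) 0)
  (trans (+-identityʳ _) (coeff-map a q 0))

coeff-⊛-suc : ∀ a p q n → coeff ((a ∷ p) ⊛ q) (suc n) ≡ a * coeff q (suc n) + coeff (p ⊛ q) n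
coeff-⊛-suc a p q n = trans (coeff-⊕ (map (a *_) q) (0ℚ ∷ p ⊛ q) (suc n))
  (cong (_+ coeff (p ⊛ q) n) (coeff-map a q (suc n)))

coeff-⊛-zeroʳ : ∀ p b q → coeff (p ⊛ (b ∷ q)) 0 ≡ b * coeff p 0
coeff-⊛-zeroʳ []      b q = sym (*-zeroʳ b)
coeff-⊛-zeroʳ (a ∷ p) b q = trans (coeff-⊛-zero a p (b ∷ q)) (*-comm a b)

-- The recursion in the right factor mirrors the one that defines `_⊛_` in the left factor;
-- comparing the two yields commutativity.
coeff-⊛-sucʳ : ∀ p b q n → coeff (p ⊛ (b ∷ q)) (suc n) ≡ b * coeff p (suc n) + coeff (p ⊛ q) n
coeff-⊛-sucʳ []      b q n = sym (trans (+-identityʳ (b * 0ℚ)) (*-zeroʳ b))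
coeff-⊛-sucʳ (a ∷ p) b q zero = begin
  coeff ((a ∷ p) ⊛ (b ∷ q)) 1                 ≡⟨ coeff-⊛-suc a p (b ∷ q) 0 ⟩
  a * coeff q 0 + coeff (p ⊛ (b ∷ q)) 0       ≡⟨ cong (a * coeff q 0 +_) (coeff-⊛-zeroʳ p b q) ⟩
  a * coeff q 0 + b * coeff p 0               ≡⟨ +-comm (a * coeff q 0) _ ⟩
  b * coeff p 0 + a * coeff q 0               ≡⟨ cong (b * coeff p 0 +_) (coeff-⊛-zero a p q) ⟨
  b * coeff p 0 + coeff ((a ∷ p) ⊛ q) 0       ∎
  where open ≡-Reasoning
coeff-⊛-sucʳ (a ∷ p) b q (suc n) = begin
  coeff ((a ∷ p) ⊛ (b ∷ q)) (2 ℕ.+ n)                                        ≡⟨ coeff-⊛-suc a p (b ∷ q) (suc n) ⟩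
  a * coeff q (suc n) + coeff (p ⊛ (b ∷ q)) (suc n)
    ≡⟨ cong (a * coeff q (suc n) +_) (coeff-⊛-sucʳ p b q n) ⟩
  a * coeff q (suc n) + (b * coeff p (suc n) + coeff (p ⊛ q) n)
    ≡⟨ e (a * coeff q (suc n)) (b * coeff p (suc n)) (coeff (p ⊛ q) n) ⟩
  b * coeff p (suc n) + (a * coeff q (suc n) + coeff (p ⊛ q) n)
    ≡⟨ cong (b * coeff p (suc n) +_) (coeff-⊛-suc a p q n) ⟨
  b * coeff p (suc n) + coeff ((a ∷ p) ⊛ q) (suc n)                          ∎
  where
  open ≡-Reasoning
  e : ∀ x y z → x + (y + z) ≡ y + (x + z)
  e = solve-∀ ℚ-ring

⊛-zeroʳ : ∀ p → p ⊛ [] ≈ []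
⊛-zeroʳ []      n       = refl
⊛-zeroʳ (a ∷ p) zero    = refl
⊛-zeroʳ (a ∷ p) (suc n) = ⊛-zeroʳ p n

⊛-comm : ∀ p q → p ⊛ q ≈ q ⊛ p
⊛-comm []      q n       = sym (⊛-zeroʳ q n)
⊛-comm (a ∷ p) q zero    = trans (coeff-⊛-zero a p q) (sym (coeff-⊛-zeroʳ q a p))
⊛-comm (a ∷ p) q (suc n) = trans (coeff-⊛-suc a p q n)
  (trans (cong (a * coeff q (suc n) +_) (⊛-comm p q n)) (sym (coeff-⊛-sucʳ q a p n)))

⊛-congˡ : ∀ p q r → q ≈ r → p ⊛ q ≈ p ⊛ r
⊛-congˡ []      q r q≈r n = refl
⊛-congˡ (a ∷ p) q r q≈r zero =
  trans (coeff-⊛-zero a p q) (trans (cong (a *_) (q≈r 0)) (sym (coeff-⊛-zero a p r)))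
⊛-congˡ (a ∷ p) q r q≈r (suc n) = trans (coeff-⊛-suc a p q n)
  (trans (cong₂ (λ x y → a * x + y) (q≈r (suc n)) (⊛-congˡ p q r q≈r n)) (sym (coeff-⊛-suc a p r n)))

⊛-cong : ∀ p q r s → p ≈ q → r ≈ s → p ⊛ r ≈ q ⊛ s
⊛-cong p q r s p≈q r≈s n = begin
  coeff (p ⊛ r) n ≡⟨ ⊛-congˡ p r s r≈s n ⟩
  coeff (p ⊛ s) n ≡⟨ ⊛-comm p s n ⟩
  coeff (s ⊛ p) n ≡⟨ ⊛-congˡ s p q p≈q n ⟩
  coeff (s ⊛ q) n ≡⟨ ⊛-comm s q n ⟩
  coeff (q ⊛ s) n ∎
  where open ≡-Reasoning

⊛-identityʳ : ∀ p → p ⊛ 1# ≈ p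
⊛-identityʳ p zero = trans (coeff-⊛-zeroʳ p 1ℚ []) (*-identityˡ (coeff p 0))
⊛-identityʳ p (suc n) = trans (coeff-⊛-sucʳ p 1ℚ [] n)
  (trans (cong₂ _+_ (*-identityˡ (coeff p (suc n))) (⊛-zeroʳ p n)) (+-identityʳ _))

map-⊛-map : ∀ c d p q → map (c *_) p ⊛ map (d *_) q ≈ map (c * d *_) (p ⊛ q)
map-⊛-map c d []      q n = refl
map-⊛-map c d (a ∷ p) q zero = begin
  coeff ((c * a ∷ map (c *_) p) ⊛ map (d *_) q) 0   ≡⟨ coeff-⊛-zero (c * a) (map (c *_) p) (map (d *_) q) ⟩
  c * a * coeff (map (d *_) q) 0                    ≡⟨ cong (c * a *_) (coeff-map d q 0) ⟩
  c * a * (d * coeff q 0)                           ≡⟨ e c d a (coeff q 0) ⟩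
  c * d * (a * coeff q 0)                           ≡⟨ cong (c * d *_) (coeff-⊛-zero a p q) ⟨
  c * d * coeff ((a ∷ p) ⊛ q) 0                     ≡⟨ coeff-map (c * d) ((a ∷ p) ⊛ q) 0 ⟨
  coeff (map (c * d *_) ((a ∷ p) ⊛ q)) 0            ∎
  where
  open ≡-Reasoning
  e : ∀ c d a x → c * a * (d * x) ≡ c * d * (a * x)
  e = solve-∀ ℚ-ring
map-⊛-map c d (a ∷ p) q (suc n) = begin
  coeff ((c * a ∷ map (c *_) p) ⊛ map (d *_) q) (suc n)
    ≡⟨ coeff-⊛-suc (c * a) (map (c *_) p) (map (d *_) q) n ⟩
  c * a * coeff (map (d *_) q) (suc n) + coeff (map (c *_) p ⊛ map (d *_) q) n
    ≡⟨ cong₂ (λ x y → c * a * x + y) (coeff-map d q (suc n)) (trans (map-⊛-map c d p q n) (coeff-map (c * d) (p ⊛ q) n)) ⟩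
  c * a * (d * coeff q (suc n)) + c * d * coeff (p ⊛ q) n
    ≡⟨ e c d a (coeff q (suc n)) (coeff (p ⊛ q) n) ⟩
  c * d * (a * coeff q (suc n) + coeff (p ⊛ q) n)
    ≡⟨ cong (c * d *_) (coeff-⊛-suc a p q n) ⟨
  c * d * coeff ((a ∷ p) ⊛ q) (suc n)
    ≡⟨ coeff-map (c * d) ((a ∷ p) ⊛ q) (suc n) ⟨
  coeff (map (c * d *_) ((a ∷ p) ⊛ q)) (suc n)                                       ∎
  where
  open ≡-Reasoning
  e : ∀ c d a x y → c * a * (d * x) + c * d * y ≡ c * d * (a * x + y)
  e = solve-∀ ℚ-ring

eval-≈0 : ∀ p x → p ≈ 0# → eval p x ≡ 0ℚ
eval-≈0 []      x p≈0 = refl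
eval-≈0 (a ∷ p) x p≈0 = trans (cong₂ (λ y z → y + x * z) (p≈0 0) (eval-≈0 p x (p≈0 ∘ suc)))
  (trans (+-identityˡ _) (*-zeroʳ x))

eval-cong : ∀ p q x → p ≈ q → eval p x ≡ eval q x
eval-cong []      q       x p≈q = sym (eval-≈0 q x (sym ∘ p≈q))
eval-cong (a ∷ p) []      x p≈q = eval-≈0 (a ∷ p) x p≈q
eval-cong (a ∷ p) (b ∷ q) x p≈q = cong₂ (λ y z → y + x * z) (p≈q 0) (eval-cong p q x (p≈q ∘ suc))

eval-⊕ : ∀ p q x → eval (p ⊕ q) x ≡ eval p x + eval q x
eval-⊕ []      q       x = sym (+-identityˡ _)
eval-⊕ (a ∷ p) []      x = sym (+-identityʳ _)
eval-⊕ (a ∷ p) (b ∷ q) x = trans (cong (λ z → a + b + x * z) (eval-⊕ p q x)) (e a b x (eval p x) (eval q x))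
  where
  e : ∀ a b x y z → a + b + x * (y + z) ≡ a + x * y + (b + x * z)
  e = solve-∀ ℚ-ring

eval-map : ∀ c p x → eval (map (c *_) p) x ≡ c * eval p x
eval-map c []      x = sym (*-zeroʳ c)
eval-map c (a ∷ p) x = trans (cong (λ z → c * a + x * z) (eval-map c p x)) (e c a x (eval p x))
  where
  e : ∀ c a x y → c * a + x * (c * y) ≡ c * (a + x * y)
  e = solve-∀ ℚ-ring

eval-⊛ : ∀ p q x → eval (p ⊛ q) x ≡ eval p x * eval q x
eval-⊛ []      q x = sym (*-zeroˡ (eval q x))
eval-⊛ (a ∷ p) q x = begin
  eval (map (a *_) q ⊕ (0ℚ ∷ p ⊛ q)) x               ≡⟨ eval-⊕ (map (a *_) q) (0ℚ ∷ p ⊛ q) x ⟩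
  eval (map (a *_) q) x + (0ℚ + x * eval (p ⊛ q) x)
    ≡⟨ cong₂ (λ y z → y + (0ℚ + x * z)) (eval-map a q x) (eval-⊛ p q x) ⟩
  a * eval q x + (0ℚ + x * (eval p x * eval q x))    ≡⟨ e a x (eval p x) (eval q x) ⟩
  (a + x * eval p x) * eval q x                      ∎
  where
  open ≡-Reasoning
  e : ∀ a x y z → a * z + (0ℚ + x * (y * z)) ≡ (a + x * y) * z
  e = solve-∀ ℚ-ring

root-⊛ˡ : ∀ p f k x → p ≈ f ⊛ k → IsRoot f x → IsRoot p x
root-⊛ˡ p f k x p≈fk fx≡0 = trans (eval-cong p (f ⊛ k) x p≈fk) (trans (eval-⊛ f k x)
  (trans (cong (_* eval k x) fx≡0) (*-zeroˡ (eval k x))))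

-- Degrees and units.

HasDegree-cong : ∀ p q {n} → p ≈ q → HasDegree p n → HasDegree q n
HasDegree-cong p q {n} p≈q (pₙ≢0 , p>n) =
  (λ qₙ≡0 → pₙ≢0 (trans (p≈q n) qₙ≡0)) , λ m n<m → trans (sym (p≈q m)) (p>n m n<m)

HasDegree-unique : ∀ p {m n} → HasDegree p m → HasDegree p n → m ≡ n
HasDegree-unique p {m} {n} (pₘ≢0 , p>m) (pₙ≢0 , p>n) with ℕ.<-cmp m n
... | tri< m<n _ _ = ⊥-elim (pₙ≢0 (p>m n m<n))
... | tri≈ _ m≡n _ = m≡n
... | tri> _ _ n<m = ⊥-elim (pₘ≢0 (p>n m n<m))

-- Because of possible trailing zeros the tail is decided first; the head is the leading coefficient
-- only if the tail vanishes.
zero-or-degree : ∀ p → p ≈ 0# ⊎ ∃[ n ] HasDegree p n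
zero-or-degree [] = inj₁ λ _ → refl
zero-or-degree (a ∷ p) with zero-or-degree p
... | inj₂ (n , pₙ≢0 , p>n) = inj₂ (suc n , pₙ≢0 , λ { (suc m) (s≤s n<m) → p>n m n<m })
... | inj₁ p≈0 with a ≟ 0ℚ
...   | yes a≡0 = inj₁ λ { zero → a≡0 ; (suc n) → p≈0 n }
...   | no a≢0 = inj₂ (0 , a≢0 , λ { (suc m) _ → p≈0 m })

≈0-⊛ : ∀ p q → p ≈ 0# → p ⊛ q ≈ 0#
≈0-⊛ p q p≈0 = ⊛-cong p 0# q q p≈0 (λ _ → refl)

coeff-⊛-above : ∀ p q {m n} → (∀ i → m ℕ.< i → coeff p i ≡ 0ℚ) → (∀ i → n ℕ.< i → coeff q i ≡ 0ℚ) →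
  ∀ i → m ℕ.+ n ℕ.< i → coeff (p ⊛ q) i ≡ 0ℚ
coeff-⊛-above []      q         p>m q>n i       _ = refl
coeff-⊛-above (a ∷ p) q {zero} {n} p>m q>n (suc i) (s≤s n≤i) = begin
  coeff ((a ∷ p) ⊛ q) (suc i)              ≡⟨ coeff-⊛-suc a p q i ⟩
  a * coeff q (suc i) + coeff (p ⊛ q) i
    ≡⟨ cong₂ (λ x y → a * x + y) (q>n (suc i) (s≤s n≤i)) (≈0-⊛ p q (λ j → p>m (suc j) (s≤s z≤n)) i) ⟩
  a * 0ℚ + 0ℚ                              ≡⟨ +-identityʳ (a * 0ℚ) ⟩
  a * 0ℚ                                   ≡⟨ *-zeroʳ a ⟩
  0ℚ                                       ∎
  where open ≡-Reasoning
coeff-⊛-above (a ∷ p) q {suc m} {n} p>m q>n (suc i) (s≤s m+n<i) = begin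
  coeff ((a ∷ p) ⊛ q) (suc i)              ≡⟨ coeff-⊛-suc a p q i ⟩
  a * coeff q (suc i) + coeff (p ⊛ q) i
    ≡⟨ cong₂ (λ x y → a * x + y) (q>n (suc i) (ℕ.m≤n⇒m≤1+n (ℕ.≤-trans (s≤s (ℕ.m≤n+m n m)) m+n<i)))
                                                (coeff-⊛-above p q (λ j m<j → p>m (suc j) (s≤s m<j)) q>n i m+n<i) ⟩
  a * 0ℚ + 0ℚ                              ≡⟨ +-identityʳ (a * 0ℚ) ⟩
  a * 0ℚ                                   ≡⟨ *-zeroʳ a ⟩
  0ℚ                                       ∎
  where open ≡-Reasoning

coeff-⊛-top : ∀ p q {m n} → (∀ i → m ℕ.< i → coeff p i ≡ 0ℚ) → (∀ i → n ℕ.< i → coeff q i ≡ 0ℚ) →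
  coeff (p ⊛ q) (m ℕ.+ n) ≡ coeff p m * coeff q n
coeff-⊛-top []      q {m} {n}      p>m q>n = sym (*-zeroˡ (coeff q n))
coeff-⊛-top (a ∷ p) q {zero} {zero}  p>m q>n = coeff-⊛-zero a p q
coeff-⊛-top (a ∷ p) q {zero} {suc n} p>m q>n = begin
  coeff ((a ∷ p) ⊛ q) (suc n)              ≡⟨ coeff-⊛-suc a p q n ⟩
  a * coeff q (suc n) + coeff (p ⊛ q) n
    ≡⟨ cong (a * coeff q (suc n) +_) (≈0-⊛ p q (λ j → p>m (suc j) (s≤s z≤n)) n) ⟩
  a * coeff q (suc n) + 0ℚ                 ≡⟨ +-identityʳ _ ⟩
  a * coeff q (suc n)                      ∎
  where open ≡-Reasoning
coeff-⊛-top (a ∷ p) q {suc m} {n} p>m q>n = begin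
  coeff ((a ∷ p) ⊛ q) (suc (m ℕ.+ n))                      ≡⟨ coeff-⊛-suc a p q (m ℕ.+ n) ⟩
  a * coeff q (suc (m ℕ.+ n)) + coeff (p ⊛ q) (m ℕ.+ n)
    ≡⟨ cong₂ (λ x y → a * x + y) (q>n (suc (m ℕ.+ n)) (s≤s (ℕ.m≤n+m n m)))
                                                                (coeff-⊛-top p q (λ j m<j → p>m (suc j) (s≤s m<j)) q>n) ⟩
  a * 0ℚ + coeff p m * coeff q n                           ≡⟨ cong (_+ coeff p m * coeff q n) (*-zeroʳ a) ⟩
  0ℚ + coeff p m * coeff q n                               ≡⟨ +-identityˡ _ ⟩
  coeff p m * coeff q n                                    ∎
  where open ≡-Reasoning

HasDegree-⊛ : ∀ p q {m n} → HasDegree p m → HasDegree q n → HasDegree (p ⊛ q) (m ℕ.+ n)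
HasDegree-⊛ p q {m} {n} (pₘ≢0 , p>m) (qₙ≢0 , q>n) =
  (λ eq → qₙ≢0 (x*y≡0⇒x≡0 (coeff q n) (coeff p m) pₘ≢0
    (trans (*-comm (coeff q n) (coeff p m)) (trans (sym (coeff-⊛-top p q p>m q>n)) eq)))) ,
  coeff-⊛-above p q p>m q>n

-- Neither factor of a non-zero product vanishes, so both have degrees, and uniqueness of the degree
-- of the product fixes their sum.
degrees-of-factors : ∀ p f k {d} → HasDegree p d → p ≈ f ⊛ k →
  ∃[ m ] ∃[ n ] (HasDegree f m × HasDegree k n × m ℕ.+ n ≡ d)
degrees-of-factors p f k {d} deg-p p≈fk = go (zero-or-degree f) (zero-or-degree k)
  where
  go : f ≈ 0# ⊎ ∃[ m ] HasDegree f m → k ≈ 0# ⊎ ∃[ n ] HasDegree k n →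
    ∃[ m ] ∃[ n ] (HasDegree f m × HasDegree k n × m ℕ.+ n ≡ d)
  go (inj₁ f≈0) _ = ⊥-elim (proj₁ deg-p (trans (p≈fk d) (≈0-⊛ f k f≈0 d)))
  go _ (inj₁ k≈0) = ⊥-elim (proj₁ deg-p (trans (p≈fk d) (trans (⊛-congˡ f k 0# k≈0 d) (⊛-zeroʳ f d))))
  go (inj₂ (m , deg-f)) (inj₂ (n , deg-k)) =
    m , n , deg-f , deg-k ,
      HasDegree-unique p (HasDegree-cong (f ⊛ k) p (≈-sym p (f ⊛ k) p≈fk) (HasDegree-⊛ f k deg-f deg-k)) deg-p

HasDegree-1# : HasDegree 1# 0
HasDegree-1# = (λ ()) , λ { (suc m) _ → refl }

unit⇒degree≡0 : ∀ p {n} → HasDegree p n → p ∣ 1# → n ≡ 0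
unit⇒degree≡0 p {n} deg-p (z , zp≈1) with degrees-of-factors 1# z p HasDegree-1# (≈-sym (z ⊛ p) 1# zp≈1)
... | m , n′ , _ , deg-p′ , m+n′≡0 = trans (HasDegree-unique p deg-p deg-p′) (ℕ.m+n≡0⇒n≡0 m m+n′≡0)

degree-0⇒unit : ∀ p → HasDegree p 0 → p ∣ 1#
degree-0⇒unit p (p₀≢0 , p>0) = (1/ coeff p 0 ∷ []) , λ
  { zero → trans (coeff-⊛-zero (1/ coeff p 0) [] p) (*-inverseˡ (coeff p 0))
  ; (suc n) → trans (coeff-⊛-suc (1/ coeff p 0) [] p n)
      (trans (+-identityʳ _) (trans (cong (1/ coeff p 0 *_) (p>0 (suc n) (s≤s z≤n))) (*-zeroʳ (1/ coeff p 0))))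
  }
  where
  instance
    p₀-nonZero : NonZero (coeff p 0)
    p₀-nonZero = ≢-nonZero p₀≢0

≈-applyUpTo : ∀ (f : ℕ → ℚ) n → (∀ i → n ℕ.≤ i → f i ≡ 0ℚ) → ∀ i → f i ≡ coeff (applyUpTo f n) i
≈-applyUpTo f zero    f≥n i       = f≥n i z≤n
≈-applyUpTo f (suc n) f≥n zero    = refl
≈-applyUpTo f (suc n) f≥n (suc i) = ≈-applyUpTo (f ∘ suc) n (λ j n≤j → f≥n (suc j) (s≤s n≤j)) i

HasDegree⇒≈ : ∀ p {n} → HasDegree p n → p ≈ applyUpTo (coeff p) (suc n)
HasDegree⇒≈ p {n} (_ , p>n) = ≈-applyUpTo (coeff p) (suc n) p>n

-- Roots and irreducibility of cubics.

linear-root : ∀ p → HasDegree p 1 → ∃[ r ] IsRoot p r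
linear-root p deg@(p₁≢0 , _) = r , trans (eval-cong p (b ∷ a ∷ []) r (HasDegree⇒≈ p deg)) root
  where
  instance
    p₁-nonZero : NonZero (coeff p 1)
    p₁-nonZero = ≢-nonZero p₁≢0
  a b r : ℚ
  a = coeff p 1
  b = coeff p 0
  r = - (1/ a * b)
  e : ∀ a b i → b + - (i * b) * (a + - (i * b) * 0ℚ) ≡ b - i * a * b
  e = solve-∀ ℚ-ring
  root : b + r * (a + r * 0ℚ) ≡ 0ℚ
  root = trans (e a b (1/ a)) (trans (cong (λ z → b - z * b) (*-inverseˡ a))
    (trans (cong (λ z → b - z) (*-identityˡ b)) (+-inverseʳ b)))

-- If two non-constant factors have degrees adding up to 3, one of them is linear and has a root.
rootless-cubic-irreducible : ∀ p → HasDegree p 3 → (∀ r → ¬ IsRoot p r) → Irreducible p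
rootless-cubic-irreducible p deg-p rootless = record
  { p∤1 = λ p∣1 → contradiction (unit⇒degree≡0 p deg-p p∣1) λ ()
  ; split-∣1 = λ {x} {y} p≈xy → split x y p≈xy (degrees-of-factors p x y deg-p p≈xy)
  }
  where
  split : ∀ x y → p ≈ x ⊛ y → ∃[ m ] ∃[ n ] (HasDegree x m × HasDegree y n × m ℕ.+ n ≡ 3) → x ∣ 1# ⊎ y ∣ 1#
  split x y p≈xy (0 , n , deg-x , _) = inj₁ (degree-0⇒unit x deg-x)
  split x y p≈xy (1 , n , deg-x , _) = let r , xr≡0 = linear-root x deg-x in
    ⊥-elim (rootless r (root-⊛ˡ p x y r p≈xy xr≡0))
  split x y p≈xy (2 , .1 , _ , deg-y , refl) = let r , yr≡0 = linear-root y deg-y in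
    ⊥-elim (rootless r (root-⊛ˡ p y x r (≈-trans p (x ⊛ y) (y ⊛ x) p≈xy (⊛-comm x y)) yr≡0))
  split x y p≈xy (3 , .0 , _ , deg-y , refl) = inj₂ (degree-0⇒unit y deg-y)
  split x y p≈xy (suc (suc (suc (suc _))) , _ , _ , _ , ())

irreducible-cubic-rootless : ∀ p → HasDegree p 3 → Irreducible p → ∀ r → ¬ IsRoot p r
irreducible-cubic-rootless p deg-p@(p₃≢0 , _) irr r pr≡0 =
  [ (λ u → contradiction (unit⇒degree≡0 linear linear-degree u) λ ())
  , (λ u → contradiction (unit⇒degree≡0 quotient quotient-degree u) λ ())
  ]′ (Irreducible.split-∣1 irr {linear} {quotient} factorisation)
  where
  p₀ p₁ p₂ p₃ : ℚ
  p₀ = coeff p 0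
  p₁ = coeff p 1
  p₂ = coeff p 2
  p₃ = coeff p 3
  linear quotient : Poly
  linear = - r ∷ 1ℚ ∷ []
  -- Synthetic division by x - r in Horner form; the remainder is p(r) = 0.
  quotient = p₁ + r * (p₂ + r * p₃) ∷ p₂ + r * p₃ ∷ p₃ ∷ []
  linear-degree : HasDegree linear 1
  linear-degree = (λ ()) , λ { (suc (suc m)) _ → refl ; (suc zero) (s≤s ()) }
  quotient-degree : HasDegree quotient 2
  quotient-degree = p₃≢0 , λ { (suc (suc (suc m))) _ → refl ; (suc (suc zero)) (s≤s (s≤s ())) ; (suc zero) (s≤s ()) }
  e₀ : ∀ r p₀ p₁ p₂ p₃ → - r * (p₁ + r * (p₂ + r * p₃)) + 0ℚ ≡ p₀ - (p₀ + r * (p₁ + r * (p₂ + r * (p₃ + r * 0ℚ))))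
  e₀ = solve-∀ ℚ-ring
  e₁ : ∀ r p₁ p₂ p₃ → p₁ ≡ - r * (p₂ + r * p₃) + (1ℚ * (p₁ + r * (p₂ + r * p₃)) + 0ℚ)
  e₁ = solve-∀ ℚ-ring
  e₂ : ∀ r p₂ p₃ → p₂ ≡ - r * p₃ + 1ℚ * (p₂ + r * p₃)
  e₂ = solve-∀ ℚ-ring
  horner≡0 : eval (applyUpTo (coeff p) 4) r ≡ 0ℚ
  horner≡0 = trans (sym (eval-cong p (applyUpTo (coeff p) 4) r (HasDegree⇒≈ p deg-p))) pr≡0
  factorisation : p ≈ linear ⊛ quotient
  factorisation = ≈-trans p (applyUpTo (coeff p) 4) (linear ⊛ quotient) (HasDegree⇒≈ p deg-p) λ
    { 0 → sym (trans (e₀ r p₀ p₁ p₂ p₃) (trans (cong (λ z → p₀ - z) horner≡0) (+-identityʳ p₀)))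
    ; 1 → e₁ r p₁ p₂ p₃
    ; 2 → e₂ r p₂ p₃
    ; 3 → sym (*-identityˡ p₃)
    ; (suc (suc (suc (suc _)))) → refl
    }

monic-coefficients : ∀ (f : ℕ → ℚ) n → f n ≡ 1ℚ → (∀ i → n ℕ.< i → f i ≡ 0ℚ) →
  ∀ i → f i ≡ coeff (applyUpTo f n ++ 1ℚ ∷ []) i
monic-coefficients f zero    fₙ≡1 f>n zero    = fₙ≡1
monic-coefficients f zero    fₙ≡1 f>n (suc i) = f>n (suc i) (s≤s z≤n)
monic-coefficients f (suc n) fₙ≡1 f>n zero    = refl
monic-coefficients f (suc n) fₙ≡1 f>n (suc i) =
  monic-coefficients (f ∘ suc) n fₙ≡1 (λ j n<j → f>n (suc j) (s≤s n<j)) i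

-- The top entry is the literal `1ℚ`, so that products of such lists reduce to the coefficient
-- equations from which factors are eliminated later.
monic-rescale : ∀ f {m} c → HasDegree f m → c * coeff f m ≡ 1ℚ →
  map (c *_) f ≈ applyUpTo (coeff (map (c *_) f)) m ++ 1ℚ ∷ []
monic-rescale f {m} c (_ , f>m) cfₘ≡1 = monic-coefficients (coeff (map (c *_) f)) m
  (trans (coeff-map c f m) cfₘ≡1)
  (λ i m<i → trans (coeff-map c f i) (trans (cong (c *_) (f>m i m<i)) (*-zeroʳ c)))

-- The leading coefficients of f and k are mutually inverse, so each factor may be divided by its own.
monic-factors : ∀ p f k {m n} → HasDegree f m → HasDegree k n → coeff p (m ℕ.+ n) ≡ 1ℚ → p ≈ f ⊛ k →
  ∃[ c ] ∃[ d ] (c ≢ 0ℚ × d ≢ 0ℚ ×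
    p ≈ (applyUpTo (coeff (map (c *_) f)) m ++ 1ℚ ∷ []) ⊛ (applyUpTo (coeff (map (d *_) k)) n ++ 1ℚ ∷ []) ×
    map (c *_) f ≈ applyUpTo (coeff (map (c *_) f)) m ++ 1ℚ ∷ [] ×
    map (d *_) k ≈ applyUpTo (coeff (map (d *_) k)) n ++ 1ℚ ∷ [])
monic-factors p f k {m} {n} deg-f@(fₘ≢0 , f>m) deg-k@(kₙ≢0 , k>n) pₘ₊ₙ≡1 p≈fk =
  kₙ , fₘ , kₙ≢0 , fₘ≢0 , p≈ , f≈ , k≈
  where
  fₘ kₙ : ℚ
  fₘ = coeff f m
  kₙ = coeff k n
  fₘkₙ≡1 : fₘ * kₙ ≡ 1ℚ
  fₘkₙ≡1 = trans (sym (coeff-⊛-top f k f>m k>n)) (trans (sym (p≈fk (m ℕ.+ n))) pₘ₊ₙ≡1)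
  kₙfₘ≡1 : kₙ * fₘ ≡ 1ℚ
  kₙfₘ≡1 = trans (*-comm kₙ fₘ) fₘkₙ≡1
  f≈ : map (kₙ *_) f ≈ applyUpTo (coeff (map (kₙ *_) f)) m ++ 1ℚ ∷ []
  f≈ = monic-rescale f kₙ deg-f kₙfₘ≡1
  k≈ : map (fₘ *_) k ≈ applyUpTo (coeff (map (fₘ *_) k)) n ++ 1ℚ ∷ []
  k≈ = monic-rescale k fₘ deg-k fₘkₙ≡1
  p≈ : p ≈ (applyUpTo (coeff (map (kₙ *_) f)) m ++ 1ℚ ∷ []) ⊛ (applyUpTo (coeff (map (fₘ *_) k)) n ++ 1ℚ ∷ [])
  p≈ i = begin
    coeff p i                                        ≡⟨ p≈fk i ⟩
    coeff (f ⊛ k) i                                  ≡⟨ *-identityˡ _ ⟨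
    1ℚ * coeff (f ⊛ k) i                             ≡⟨ cong (_* coeff (f ⊛ k) i) kₙfₘ≡1 ⟨
    kₙ * fₘ * coeff (f ⊛ k) i                        ≡⟨ coeff-map (kₙ * fₘ) (f ⊛ k) i ⟨
    coeff (map (kₙ * fₘ *_) (f ⊛ k)) i               ≡⟨ map-⊛-map kₙ fₘ f k i ⟨
    coeff (map (kₙ *_) f ⊛ map (fₘ *_) k) i
      ≡⟨ ⊛-cong (map (kₙ *_) f) (applyUpTo (coeff (map (kₙ *_) f)) m ++ 1ℚ ∷ [])
                 (map (fₘ *_) k) (applyUpTo (coeff (map (fₘ *_) k)) n ++ 1ℚ ∷ []) f≈ k≈ i ⟩
    coeff ((applyUpTo (coeff (map (kₙ *_) f)) m ++ 1ℚ ∷ []) ⊛ (applyUpTo (coeff (map (fₘ *_) k)) n ++ 1ℚ ∷ [])) i ∎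
    where open ≡-Reasoning

coeff-beyond-length : ∀ p n → length p ℕ.≤ n → coeff p n ≡ 0ℚ
coeff-beyond-length []      n       _         = refl
coeff-beyond-length (a ∷ p) (suc n) (s≤s len) = coeff-beyond-length p n len

-- From (x² - v) p ≈ (x² - v) q, the coefficient of xⁿ in p - q is v times that of xⁿ⁺²,
-- and it vanishes beyond both lengths.
cancel-x²-v : ∀ v p q → (- v ∷ 0ℚ ∷ 1ℚ ∷ []) ⊛ p ≈ (- v ∷ 0ℚ ∷ 1ℚ ∷ []) ⊛ q → p ≈ q
cancel-x²-v v p q eq n = go (length p ℕ.+ length q) n (ℕ.m≤m+n _ n)
  where
  open ≡-Reasoning
  coeff-x²-v : ∀ p n → coeff ((- v ∷ 0ℚ ∷ 1ℚ ∷ []) ⊛ p) (2 ℕ.+ n) ≡ - v * coeff p (2 ℕ.+ n) + coeff p n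
  coeff-x²-v p n = begin
    coeff ((- v ∷ 0ℚ ∷ 1ℚ ∷ []) ⊛ p) (2 ℕ.+ n)
      ≡⟨ coeff-⊛-suc (- v) (0ℚ ∷ 1ℚ ∷ []) p (suc n) ⟩
    - v * coeff p (2 ℕ.+ n) + coeff ((0ℚ ∷ 1ℚ ∷ []) ⊛ p) (suc n)
      ≡⟨ cong (- v * coeff p (2 ℕ.+ n) +_) (coeff-⊛-suc 0ℚ (1ℚ ∷ []) p n) ⟩
    - v * coeff p (2 ℕ.+ n) + (0ℚ * coeff p (suc n) + coeff (1# ⊛ p) n)
      ≡⟨ cong (λ z → - v * coeff p (2 ℕ.+ n) + (0ℚ * coeff p (suc n) + z)) (trans (⊛-comm 1# p n) (⊛-identityʳ p n)) ⟩
    - v * coeff p (2 ℕ.+ n) + (0ℚ * coeff p (suc n) + coeff p n)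
      ≡⟨ e (- v * coeff p (2 ℕ.+ n)) (coeff p (suc n)) (coeff p n) ⟩
    - v * coeff p (2 ℕ.+ n) + coeff p n                                             ∎
    where
    e : ∀ x y z → x + (0ℚ * y + z) ≡ x + z
    e = solve-∀ ℚ-ring
  -- Each step raises n by 2 and lowers `fuel` by 1, which preserves the bound; with no fuel left, n
  -- lies beyond both lists.
  go : ∀ fuel n → length p ℕ.+ length q ℕ.≤ fuel ℕ.+ n → coeff p n ≡ coeff q n
  go zero n len≤n = trans (coeff-beyond-length p n (ℕ.m+n≤o⇒m≤o (length p) len≤n))
    (sym (coeff-beyond-length q n (ℕ.m+n≤o⇒n≤o (length p) len≤n)))
  go (suc fuel) n len≤ = +-cancelˡ (- v * coeff p (2 ℕ.+ n)) (coeff p n) (coeff q n) (begin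
    - v * coeff p (2 ℕ.+ n) + coeff p n            ≡⟨ coeff-x²-v p n ⟨
    coeff ((- v ∷ 0ℚ ∷ 1ℚ ∷ []) ⊛ p) (2 ℕ.+ n)     ≡⟨ eq (2 ℕ.+ n) ⟩
    coeff ((- v ∷ 0ℚ ∷ 1ℚ ∷ []) ⊛ q) (2 ℕ.+ n)     ≡⟨ coeff-x²-v q n ⟩
    - v * coeff q (2 ℕ.+ n) + coeff q n            ≡⟨ cong (λ z → - v * z + coeff q n) (go fuel (2 ℕ.+ n) len≤′) ⟨
    - v * coeff p (2 ℕ.+ n) + coeff q n            ∎)
    where
    len≤′ : length p ℕ.+ length q ℕ.≤ fuel ℕ.+ (2 ℕ.+ n)
    len≤′ = ℕ.≤-trans len≤ (ℕ.≤-trans (ℕ.≤-reflexive (sym (ℕ.+-suc fuel n))) (ℕ.+-monoʳ-≤ fuel (ℕ.n≤1+n (suc n))))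

open import Agda.Builtin.FromNat using (Number; fromNat)
import Data.Nat.Literals as ℕLiterals
import Data.Rational.Literals as ℚLiterals
open import Data.Unit using (tt)

private instance
  numberℕ : Number ℕ
  numberℕ = ℕLiterals.number

  numberℚ : Number ℚ
  numberℚ = ℚLiterals.number

-- Concordant forms over ℚ and the elliptic curve

fromℕ : ℕ → ℚ
fromℕ n = fromℤ (ℤ.+ n)

fromℕ-injective : ∀ {m n} → fromℕ m ≡ fromℕ n → m ≡ n
fromℕ-injective refl = refl

fromℕ-+ : ∀ m n → fromℕ (m ℕ.+ n) ≡ fromℕ m + fromℕ n
fromℕ-+ m n = toℚᵘ-injective (ℚᵘ.≃-trans (ℚᵘ.*≡* (e (ℤ.+ m) (ℤ.+ n))) (ℚᵘ.≃-sym (toℚᵘ-homo-+ (fromℕ m) (fromℕ n))))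
  where
  e : ∀ i j → (i ℤ.+ j) ℤ.* (ℤ.+ 1) ≡ (i ℤ.* (ℤ.+ 1) ℤ.+ j ℤ.* (ℤ.+ 1)) ℤ.* (ℤ.+ 1)
  e = ℤ.solve-∀

fromℕ-* : ∀ m n → fromℕ (m ℕ.* n) ≡ fromℕ m * fromℕ n
fromℕ-* m n = toℚᵘ-injective (ℚᵘ.≃-trans (ℚᵘ.*≡* (cong (ℤ._* (ℤ.+ 1)) (ℤ.pos-* m n)))
  (ℚᵘ.≃-sym (toℚᵘ-homo-* (fromℕ m) (fromℕ n))))

x*↧x≡↥x : ∀ x → x * fromℤ (↧ x) ≡ fromℤ (↥ x)
x*↧x≡↥x x@record{} = toℚᵘ-injective (ℚᵘ.≃-trans (toℚᵘ-homo-* x (fromℤ (↧ x))) (ℚᵘ.*≡* (e (↥ x) (↧ x))))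
  where
  e : ∀ i j → i ℤ.* j ℤ.* (ℤ.+ 1) ≡ i ℤ.* (j ℤ.* (ℤ.+ 1))
  e = ℤ.solve-∀

fromℤ-square : ∀ i → fromℤ i * fromℤ i ≡ fromℕ ℤ.∣ i ∣ * fromℕ ℤ.∣ i ∣
fromℤ-square (ℤ.+ n) = refl
fromℤ-square (ℤ.-[1+ n ]) = refl

-- Only squares are cleared of denominators: squaring removes the sign, so the absolute value of the
-- numerator gives a natural number.
clear-square : ∀ x {e} → ↧ₙ x ℕ.∣ e → ∃[ n ] (x * x * (fromℕ e * fromℕ e) ≡ fromℕ (n ℕ.* n))
clear-square x (ℕ.divides k refl) = k ℕ.* ℤ.∣ ↥ x ∣ , (begin
  x * x * (fromℕ (k ℕ.* ↧ₙ x) * fromℕ (k ℕ.* ↧ₙ x))  ≡⟨ cong (λ z → x * x * (z * z)) (fromℕ-* k (↧ₙ x)) ⟩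
  x * x * (K * d * (K * d))                          ≡⟨ e x d K ⟩
  x * d * (x * d) * (K * K)                          ≡⟨ cong (λ z → z * z * (K * K)) (x*↧x≡↥x x) ⟩
  fromℤ (↥ x) * fromℤ (↥ x) * (K * K)                ≡⟨ cong (_* (K * K)) (fromℤ-square (↥ x)) ⟩
  n * n * (K * K)                                    ≡⟨ e′ n K ⟩
  K * n * (K * n)                                    ≡⟨ cong (λ z → z * z) (fromℕ-* k ℤ.∣ ↥ x ∣) ⟨
  fromℕ (k ℕ.* ℤ.∣ ↥ x ∣) * fromℕ (k ℕ.* ℤ.∣ ↥ x ∣)  ≡⟨ fromℕ-* (k ℕ.* ℤ.∣ ↥ x ∣) (k ℕ.* ℤ.∣ ↥ x ∣) ⟨
  fromℕ (k ℕ.* ℤ.∣ ↥ x ∣ ℕ.* (k ℕ.* ℤ.∣ ↥ x ∣))      ∎)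
  where
  open ≡-Reasoning
  d K n : ℚ
  d = fromℕ (↧ₙ x)
  K = fromℕ k
  n = fromℕ ℤ.∣ ↥ x ∣
  e : ∀ x d K → x * x * (K * d * (K * d)) ≡ x * d * (x * d) * (K * K)
  e = solve-∀ ℚ-ring
  e′ : ∀ n K → n * n * (K * K) ≡ K * n * (K * n)
  e′ = solve-∀ ℚ-ring

concordant-cleared : ∀ {s q p r} e → e ≢ 0 → ↧ₙ s ℕ.∣ e → ↧ₙ q ℕ.∣ e → ↧ₙ p ℕ.∣ e → ↧ₙ r ℕ.∣ e →
  s * s + q * q ≡ p * p → s * s + 3 * (q * q) ≡ r * r → q ≡ 0ℚ
concordant-cleared {s} {q} {p} {r} e e≢0 s∣e q∣e p∣e r∣e eqp eqr
  with clear-square s s∣e | clear-square q q∣e | clear-square p p∣e | clear-square r r∣e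
... | S , Seq | Q , Qeq | R , Req | T , Teq = square≡0⇒≡0 q qq≡0
  where
  open ≡-Reasoning
  ee : ℚ
  ee = fromℕ e * fromℕ e
  ee≢0 : ee ≢ 0ℚ
  ee≢0 ee≡0 = e≢0 (fromℕ-injective (square≡0⇒≡0 (fromℕ e) ee≡0))
  SS+QQ≡RR : S ℕ.* S ℕ.+ Q ℕ.* Q ≡ R ℕ.* R
  SS+QQ≡RR = fromℕ-injective (begin
    fromℕ (S ℕ.* S ℕ.+ Q ℕ.* Q)          ≡⟨ fromℕ-+ (S ℕ.* S) (Q ℕ.* Q) ⟩
    fromℕ (S ℕ.* S) + fromℕ (Q ℕ.* Q)    ≡⟨ cong₂ _+_ Seq Qeq ⟨
    s * s * ee + q * q * ee              ≡⟨ *-distribʳ-+ ee (s * s) (q * q) ⟨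
    (s * s + q * q) * ee                 ≡⟨ cong (_* ee) eqp ⟩
    p * p * ee                           ≡⟨ Req ⟩
    fromℕ (R ℕ.* R)                      ∎)
  SS+3QQ≡TT : S ℕ.* S ℕ.+ 3 ℕ.* (Q ℕ.* Q) ≡ T ℕ.* T
  SS+3QQ≡TT = fromℕ-injective (begin
    fromℕ (S ℕ.* S ℕ.+ 3 ℕ.* (Q ℕ.* Q))        ≡⟨ fromℕ-+ (S ℕ.* S) (3 ℕ.* (Q ℕ.* Q)) ⟩
    fromℕ (S ℕ.* S) + fromℕ (3 ℕ.* (Q ℕ.* Q))  ≡⟨ cong (fromℕ (S ℕ.* S) +_) (fromℕ-* 3 (Q ℕ.* Q)) ⟩
    fromℕ (S ℕ.* S) + 3 * fromℕ (Q ℕ.* Q)      ≡⟨ cong₂ (λ x y → x + 3 * y) Seq Qeq ⟨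
    s * s * ee + 3 * (q * q * ee)              ≡⟨ factor (s * s) (q * q) ee ⟩
    (s * s + 3 * (q * q)) * ee                 ≡⟨ cong (_* ee) eqr ⟩
    r * r * ee                                 ≡⟨ Teq ⟩
    fromℕ (T ℕ.* T)                            ∎)
    where
    factor : ∀ s q e → s * e + 3 * (q * e) ≡ (s + 3 * q) * e
    factor = solve-∀ ℚ-ring
  QQ≡0 : fromℕ (Q ℕ.* Q) ≡ 0ℚ
  QQ≡0 = cong (λ z → fromℕ (z ℕ.* z)) (concordant⇒≡0 Q (S , R , T , SS+QQ≡RR , SS+3QQ≡TT))
  qq≡0 : q * q ≡ 0ℚ
  qq≡0 = x*y≡0⇒x≡0 (q * q) ee ee≢0 (trans Qeq QQ≡0)

concordantℚ⇒≡0 : ∀ {s q p r} → s * s + q * q ≡ p * p → s * s + 3 * (q * q) ≡ r * r → q ≡ 0ℚ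
concordantℚ⇒≡0 {s} {q} {p} {r} = concordant-cleared {s} {q} {p} {r} (a ℕ.* (b ℕ.* (c ℕ.* d)))
  (ℕ*-≢0 {a} (λ ()) (ℕ*-≢0 {b} (λ ()) (ℕ*-≢0 {c} (λ ()) (λ ()))))
  (ℕ.m∣m*n {a} (b ℕ.* (c ℕ.* d))) (ℕ.∣n⇒∣m*n {b} a (ℕ.m∣m*n {b} (c ℕ.* d)))
  (ℕ.∣n⇒∣m*n {c} a (ℕ.∣n⇒∣m*n {c} b (ℕ.m∣m*n {c} d)))
  (ℕ.∣n⇒∣m*n {d} a (ℕ.∣n⇒∣m*n {d} b (ℕ.n∣m*n c {d})))
  where
  a b c d : ℕ
  a = ↧ₙ s
  b = ↧ₙ q
  c = ↧ₙ p
  d = ↧ₙ r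

-- Doubling a point of Y² = F(Z) := Z³ - 2 Z² + 9 Z and clearing denominators yields the concordant pair
-- s = (Z² - 9)² - 12 F, q = 4 Y (Z² - 9).
curve⇒Y[Z²-9]≡0 : ∀ Z Y → Y * Y ≡ Z * Z * Z - 2 * (Z * Z) + 9 * Z → Y * (Z * Z - 9) ≡ 0ℚ
curve⇒Y[Z²-9]≡0 Z Y eq = x*y≡0⇒x≡0 _ 4 (λ ()) (trans (*-comm (Y * D) 4) (concordantℚ⇒≡0
  -- The double of the point has abscissa X = D² / (4 F). Then s² + q² = 16 F² (X² - 2 X + 9) is a
  -- square, since X and X (X² - 2 X + 9) are; the quartic in Z is its root. Replacing Y² by F turns
  -- s² + 3 q² into (D² + 12 F)².
  {D * D - 12 * F} {4 * (Y * D)} {Z * Z * Z * Z - 4 * (Z * Z * Z) + 54 * (Z * Z) - 36 * Z + 81} {D * D + 12 * F}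
  (combine₁ (16 * (D * D)) eq (e₁ Z Y)) (combine₁ (48 * (D * D)) eq (e₂ Z Y))))
  where
  D F : ℚ
  D = Z * Z - 9
  F = Z * Z * Z - 2 * (Z * Z) + 9 * Z
  e₁ : ∀ Z Y →
    ((Z * Z - 9) * (Z * Z - 9) - 12 * (Z * Z * Z - 2 * (Z * Z) + 9 * Z)) *
    ((Z * Z - 9) * (Z * Z - 9) - 12 * (Z * Z * Z - 2 * (Z * Z) + 9 * Z)) +
    4 * (Y * (Z * Z - 9)) * (4 * (Y * (Z * Z - 9))) -
    (Z * Z * Z * Z - 4 * (Z * Z * Z) + 54 * (Z * Z) - 36 * Z + 81) *
    (Z * Z * Z * Z - 4 * (Z * Z * Z) + 54 * (Z * Z) - 36 * Z + 81) ≡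
    16 * ((Z * Z - 9) * (Z * Z - 9)) * (Y * Y - (Z * Z * Z - 2 * (Z * Z) + 9 * Z))
  e₁ = solve-∀ ℚ-ring
  e₂ : ∀ Z Y →
    ((Z * Z - 9) * (Z * Z - 9) - 12 * (Z * Z * Z - 2 * (Z * Z) + 9 * Z)) *
    ((Z * Z - 9) * (Z * Z - 9) - 12 * (Z * Z * Z - 2 * (Z * Z) + 9 * Z)) +
    3 * (4 * (Y * (Z * Z - 9)) * (4 * (Y * (Z * Z - 9)))) -
    ((Z * Z - 9) * (Z * Z - 9) + 12 * (Z * Z * Z - 2 * (Z * Z) + 9 * Z)) *
    ((Z * Z - 9) * (Z * Z - 9) + 12 * (Z * Z * Z - 2 * (Z * Z) + 9 * Z)) ≡
    48 * ((Z * Z - 9) * (Z * Z - 9)) * (Y * Y - (Z * Z * Z - 2 * (Z * Z) + 9 * Z))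
  e₂ = solve-∀ ℚ-ring

square-nonNegative : ∀ x → NonNegative (x * x)
square-nonNegative x with ≤-total 0ℚ x
... | inj₁ 0≤x = nonNeg*nonNeg⇒nonNeg x {{nonNegative 0≤x}} x {{nonNegative 0≤x}}
... | inj₂ x≤0 = nonPos*nonPos⇒nonPos x {{nonPositive x≤0}} x {{nonPositive x≤0}}

square+pos≢0 : ∀ x c .{{_ : Positive c}} → x * x + c ≢ 0ℚ
square+pos≢0 x c eq with () ← subst Positive eq (nonNeg+pos⇒pos (x * x) {{square-nonNegative x}} c)

-- With Y = 6 (3 q - 2 - x) and Z = 3 (2 x + 1) the equation becomes Y² = Z³ - 2 Z² + 9 Z.
cubic-point : ∀ q x → 2 * (x * x * x + x * x + q * x) ≡ (q - 1) * (3 * q - 1) → q ≡ 1ℚ ⊎ q ≡ ½ ⊎ q ≡ ⅓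
cubic-point q x eq = [ Y≡0-case , Z²≡9-case ]′ (xy≡0⇒x≡0∨y≡0 Y (Z * Z - 9) (curve⇒Y[Z²-9]≡0 Z Y on-curve))
  where
  Y Z : ℚ
  Y = 6 * (3 * q - 2 - x)
  Z = 3 * (2 * x + 1)

  on-curve : Y * Y ≡ Z * Z * Z - 2 * (Z * Z) + 9 * Z
  on-curve = combine₁ (- 108) eq (e q x)
    where
    e : ∀ q x → 6 * (3 * q - 2 - x) * (6 * (3 * q - 2 - x)) -
          (3 * (2 * x + 1) * (3 * (2 * x + 1)) * (3 * (2 * x + 1)) -
           2 * (3 * (2 * x + 1) * (3 * (2 * x + 1))) + 9 * (3 * (2 * x + 1))) ≡
          - 108 * (2 * (x * x * x + x * x + q * x) - (q - 1) * (3 * q - 1))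
    e = solve-∀ ℚ-ring

  x≡0-case : x ≡ 0ℚ → q ≡ 1ℚ ⊎ q ≡ ½ ⊎ q ≡ ⅓
  x≡0-case x≡0 = [ (λ q-1≡0 → inj₁ (x-y≡0⇒x≡y q 1 q-1≡0))
                 , (λ 3q-1≡0 → inj₂ (inj₂ (combine₁ ⅓ 3q-1≡0 (e′ q))))
                 ]′ (xy≡0⇒x≡0∨y≡0 (q - 1) (3 * q - 1) (combine₂ (- 1) eq (2 * (x * x + x + q)) x≡0 (e q x)))
    where
    e : ∀ q x → (q - 1) * (3 * q - 1) - 0 ≡
          - 1 * (2 * (x * x * x + x * x + q * x) - (q - 1) * (3 * q - 1)) + 2 * (x * x + x + q) * (x - 0)
    e = solve-∀ ℚ-ring
    e′ : ∀ q → q - ⅓ ≡ ⅓ * (3 * q - 1 - 0)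
    e′ = solve-∀ ℚ-ring

  -- Since Z² - 2 Z + 9 = (Z - 1)² + 8 is positive, Y = 0 leaves only Z = 0, so x = -1/2 and q =
  -- 1/2.
  Y≡0-case : Y ≡ 0ℚ → q ≡ 1ℚ ⊎ q ≡ ½ ⊎ q ≡ ⅓
  Y≡0-case Y≡0 = [ (λ Z≡0 → inj₂ (inj₁ (combine₂ (½ * ⅓ * ⅓) Y≡0 (½ * ⅓ * ⅓) Z≡0 (e′ q x))))
                 , (λ absurd → ⊥-elim (square+pos≢0 (Z - 1) 8 absurd))
                 ]′ (xy≡0⇒x≡0∨y≡0 Z ((Z - 1) * (Z - 1) + 8) (combine₂ (- 1) on-curve Y Y≡0 (e Z Y)))
    where
    e : ∀ Z Y → Z * ((Z - 1) * (Z - 1) + 8) - 0 ≡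
          - 1 * (Y * Y - (Z * Z * Z - 2 * (Z * Z) + 9 * Z)) + Y * (Y - 0)
    e = solve-∀ ℚ-ring
    e′ : ∀ q x → q - ½ ≡ ½ * ⅓ * ⅓ * (6 * (3 * q - 2 - x) - 0) + ½ * ⅓ * ⅓ * (3 * (2 * x + 1) - 0)
    e′ = solve-∀ ℚ-ring

  -- Z = 3 means x = 0, and Z = -3 would give Y² = -72.
  Z²≡9-case : Z * Z - 9 ≡ 0ℚ → q ≡ 1ℚ ⊎ q ≡ ½ ⊎ q ≡ ⅓
  Z²≡9-case Z²-9≡0 = [ (λ Z-3≡0 → x≡0-case (combine₁ (½ * ⅓) Z-3≡0 (e₁ x)))
                     , (λ Z+3≡0 → ⊥-elim (square+pos≢0 Y 72
                         (combine₂ 1 on-curve (Z * Z - 5 * Z + 24) Z+3≡0 (e₂ Z Y))))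
                     ]′ (xy≡0⇒x≡0∨y≡0 (Z - 3) (Z + 3) (trans (e Z) Z²-9≡0))
    where
    e : ∀ Z → (Z - 3) * (Z + 3) ≡ Z * Z - 9
    e = solve-∀ ℚ-ring
    e₁ : ∀ x → x - 0 ≡ ½ * ⅓ * (3 * (2 * x + 1) - 3 - 0)
    e₁ = solve-∀ ℚ-ring
    e₂ : ∀ Z Y → Y * Y + 72 - 0 ≡ 1 * (Y * Y - (Z * Z * Z - 2 * (Z * Z) + 9 * Z)) +
          (Z * Z - 5 * Z + 24) * (Z + 3 - 0)
    e₂ = solve-∀ ℚ-ring

-- The solution d of 2 a d = b² - v² for a = t ≠ 0, b = q t² and v = (2 q - 1) t², where b² - v² = -
-- (q - 1) (3 q - 1) t⁴.
δ⟨_,_⟩ : ℚ → ℚ → ℚ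
δ⟨ q , t ⟩ = - (½ * ((q - 1) * (3 * q - 1) * (t * t * t)))

-- The polynomial x³ + t x² + q t² x + δ, in the Horner form to which eval reduces.
cubic-rootless : ∀ {q t} → q ≢ 1ℚ → q ≢ ½ → q ≢ ⅓ → t ≢ 0ℚ →
  ∀ w → δ⟨ q , t ⟩ + w * (q * (t * t) + w * (t + w * (1ℚ + w * 0ℚ))) ≢ 0ℚ
cubic-rootless {q} {t} q≢1 q≢½ q≢⅓ t≢0 w root =
  [ q≢1 , [ q≢½ , q≢⅓ ]′ ]′ (cubic-point q x point)
  where
  instance
    t-nonZero : NonZero t
    t-nonZero = ≢-nonZero t≢0
  x : ℚ
  x = w * 1/ t
  w≡xt : w ≡ x * t
  w≡xt = sym (trans (*-assoc w (1/ t) t) (trans (cong (w *_) (*-inverseˡ t)) (*-identityʳ w)))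
  e : ∀ q t x →
        2 * (- (½ * ((q - 1) * (3 * q - 1) * (t * t * t))) +
          x * t * (q * (t * t) + x * t * (t + x * t * (1ℚ + x * t * 0ℚ)))) ≡
        (2 * (x * x * x + x * x + q * x) - (q - 1) * (3 * q - 1)) * (t * (t * t))
  e = solve-∀ ℚ-ring
  t³≢0 : t * (t * t) ≢ 0ℚ
  t³≢0 eq = [ t≢0 , t≢0 ∘ square≡0⇒≡0 t ]′ (xy≡0⇒x≡0∨y≡0 t (t * t) eq)
  point : 2 * (x * x * x + x * x + q * x) ≡ (q - 1) * (3 * q - 1)
  point = x-y≡0⇒x≡y _ _ (x*y≡0⇒x≡0 _ _ t³≢0 (trans (sym (e q t x))
    (cong (2 *_) (subst (λ z → δ⟨ q , t ⟩ + z * (q * (t * t) + z * (t + z * (1ℚ + z * 0ℚ))) ≡ 0ℚ) w≡xt root))))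

-- The hypotheses equate the coefficients of (x² + a x + b) (x⁴ + k₃ x³ + k₂ x² + k₁ x + k₀), as _⊛_ computes
-- them, with those of x⁶ + v x⁴ + v² x² + c.
quadratic-factor⇒root : ∀ {b a k₀ k₁ k₂ k₃ v c} →
  b * k₀ + 0ℚ ≡ c →
  b * k₁ + (a * k₀ + 0ℚ) ≡ 0ℚ →
  b * k₂ + (a * k₁ + (1ℚ * k₀ + 0ℚ)) ≡ v * v →
  b * k₃ + (a * k₂ + 1ℚ * k₁) ≡ 0ℚ →
  b * 1ℚ + (a * k₃ + 1ℚ * k₂) ≡ v →
  a * 1ℚ + 1ℚ * k₃ ≡ 0ℚ →
  ∃[ r ] (c + r * (v * v + r * (v + r * (1ℚ + r * 0ℚ))) ≡ 0ℚ)
quadratic-factor⇒root {b} {a} {k₀} {k₁} {k₂} {k₃} {v} refl h₁ h₂ h₃ h₄ h₅ =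
  eliminated k₃≡ k₂≡ k₁≡
  where
  k₃≡ : k₃ ≡ - a
  k₃≡ = combine₁ 1 h₅ (e a k₃)
    where
    e : ∀ a k₃ → k₃ - - a ≡ 1 * (a * 1ℚ + 1ℚ * k₃ - 0)
    e = solve-∀ ℚ-ring
  k₂≡ : k₂ ≡ v - b + a * a
  k₂≡ = combine₂ 1 h₄ (- a) k₃≡ (e a b v k₂ k₃)
    where
    e : ∀ a b v k₂ k₃ → k₂ - (v - b + a * a) ≡ 1 * (b * 1ℚ + (a * k₃ + 1ℚ * k₂) - v) + - a * (k₃ - - a)
    e = solve-∀ ℚ-ring
  k₁≡ : k₁ ≡ a * b - a * (v - b + a * a)
  k₁≡ = combine₃ 1 h₃ (- b) k₃≡ (- a) k₂≡ (e a b v k₁ k₂ k₃)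
    where
    e : ∀ a b v k₁ k₂ k₃ → k₁ - (a * b - a * (v - b + a * a)) ≡
          1 * (b * k₃ + (a * k₂ + 1ℚ * k₁) - 0) + - b * (k₃ - - a) + - a * (k₂ - (v - b + a * a))
    e = solve-∀ ℚ-ring
  Root : Set
  Root = ∃[ r ] (b * k₀ + 0ℚ + r * (v * v + r * (v + r * (1ℚ + r * 0ℚ))) ≡ 0ℚ)
  eliminated : k₃ ≡ - a → k₂ ≡ v - b + a * a → k₁ ≡ a * b - a * (v - b + a * a) → Root
  -- After the elimination the coefficient of x is a (k₀ - b (v + a² - 2 b)).
  eliminated refl refl refl = [ a≡0-case , k₀-case ∘ x-y≡0⇒x≡y _ _ ]′
    (xy≡0⇒x≡0∨y≡0 a (k₀ - b * (v + a * a - 2 * b)) (combine₁ 1 h₁ (e a b v k₀)))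
    where
    e : ∀ a b v k₀ → a * (k₀ - b * (v + a * a - 2 * b)) - 0 ≡
          1 * (b * (a * b - a * (v - b + a * a)) + (a * k₀ + 0ℚ) - 0)
    e = solve-∀ ℚ-ring
    a≡0-case : a ≡ 0ℚ → Root
    a≡0-case a≡0 = - b , combine₂ b h₂ (b * (v - 2 * b + a * a)* a - b * a * b) a≡0 (e′ a b v k₀)
      where
      e′ : ∀ a b v k₀ → b * k₀ + 0ℚ + - b * (v * v + - b * (v + - b * (1ℚ + - b * 0ℚ))) - 0 ≡
           b * (b * (v - b + a * a) + (a * (a * b - a * (v - b + a * a)) + (1ℚ * k₀ + 0ℚ)) - v * v) +
           (b * (v - 2 * b + a * a)* a - b * a * b) * (a - 0)
      e′ = solve-∀ ℚ-ring
    k₀-case : k₀ ≡ b * (v + a * a - 2 * b) → Root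
    -- In y = x² the factor and its mirror image x² - a x + b multiply to y² + (2 b - a²) y + b².
    -- The remaining linear factor of y³ + v y² + v² y + c is y + (v + a² - 2 b), which supplies the
    -- root.
    k₀-case refl = - (v + a * a - 2 * b) , combine₁ (v + a * a - 2 * b) h₂ (e′ a b v)
      where
      e′ : ∀ a b v →
           b * (b * (v + a * a - 2 * b)) + 0ℚ +
             - (v + a * a - 2 * b) * (v * v + - (v + a * a - 2 * b) * (v + - (v + a * a - 2 * b) * (1ℚ + - (v + a * a - 2 * b) * 0ℚ))) - 0 ≡
           (v + a * a - 2 * b) *
             (b * (v - b + a * a) + (a * (a * b - a * (v - b + a * a)) + (1ℚ * (b * (v + a * a - 2 * b)) + 0ℚ)) - v * v)
      e′ = solve-∀ ℚ-ring

-- The cubic factors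

-- Everything is expressed by q and a: v = (2 q - 1) a² and d = `δ⟨ q , a ⟩`, so the coefficients c
-- - v³ and - v c are homogeneous in a of degrees 6 and 8. The excluded values are the zeros of c,
-- at q = 1 and 1/3, and of v, at q = 1/2.
parameter-scaling : ∀ q {v c d b a} → v ≢ 0ℚ → c ≢ 0ℚ → a ≢ 0ℚ →
  b ≡ q * (a * a) → v ≡ 2 * b - a * a → c ≡ - (d * d) → 2 * (a * d) ≡ b * b - v * v →
  q ≢ 1ℚ × q ≢ ½ × q ≢ ⅓ × EqualUpToScaling (c - v * v * v , - (v * c)) (A⟨ q ⟩ , B⟨ q ⟩)
parameter-scaling q {d = d} {a = a} v≢0 c≢0 a≢0 refl refl refl 2ad≡ = conclude d≡δ
  where
  v′ : ℚ
  v′ = 2 * (q * (a * a)) - a * a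
  d≡δ : d ≡ δ⟨ q , a ⟩
  d≡δ = x-y≡0⇒x≡y _ _ (x*y≡0⇒x≡0 _ a a≢0 (combine₁ ½ 2ad≡ (e q d a)))
    where
    e : ∀ q d a → (d - - (½ * ((q - 1) * (3 * q - 1) * (a * a * a)))) * a - 0 ≡
          ½ * (2 * (a * d) - (q * (a * a) * (q * (a * a)) -
            (2 * (q * (a * a)) - a * a) * (2 * (q * (a * a)) - a * a)))
    e = solve-∀ ℚ-ring
  conclude : d ≡ δ⟨ q , a ⟩ → q ≢ 1ℚ × q ≢ ½ × q ≢ ⅓ ×
    EqualUpToScaling (- (d * d) - v′ * v′ * v′ , - (v′ * - (d * d))) (A⟨ q ⟩ , B⟨ q ⟩)
  conclude refl =
    (λ { refl → c≢0 (e₁ a) }) , (λ { refl → v≢0 (e₂ a) }) , (λ { refl → c≢0 (e₃ a) }) , a , a≢0 , eA q a , eB q a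
    where
    e₁ : ∀ a →
      - (- (½ * ((1ℚ - 1) * (3 * 1ℚ - 1) * (a * a * a))) * - (½ * ((1ℚ - 1) * (3 * 1ℚ - 1) * (a * a * a)))) ≡ 0ℚ
    e₁ = solve-∀ ℚ-ring
    e₂ : ∀ a → 2 * (½ * (a * a)) - a * a ≡ 0ℚ
    e₂ = solve-∀ ℚ-ring
    e₃ : ∀ a →
      - (- (½ * ((⅓ - 1) * (3 * ⅓ - 1) * (a * a * a))) * - (½ * ((⅓ - 1) * (3 * ⅓ - 1) * (a * a * a)))) ≡ 0ℚ
    e₃ = solve-∀ ℚ-ring
    eA : ∀ q a →
      - (- (½ * ((q - 1) * (3 * q - 1) * (a * a * a))) * - (½ * ((q - 1) * (3 * q - 1) * (a * a * a)))) -
      (2 * (q * (a * a)) - a * a) * (2 * (q * (a * a)) - a * a) * (2 * (q * (a * a)) - a * a) ≡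
      - ((q * (q * 1ℚ) + 2 * q - 1) * (9 * (q * (q * 1ℚ)) - 10 * q + 3) * ¼) *
      (a * (a * (a * (a * (a * (a * 1ℚ))))))
    eA = solve-∀ ℚ-ring
    eB : ∀ q a →
      - ((2 * (q * (a * a)) - a * a) *
         - (- (½ * ((q - 1) * (3 * q - 1) * (a * a * a))) * - (½ * ((q - 1) * (3 * q - 1) * (a * a * a))))) ≡
      (q - 1) * ((q - 1) * 1ℚ) * (2 * q - 1) * ((3 * q - 1) * ((3 * q - 1) * 1ℚ)) * ¼ *
      (a * (a * (a * (a * (a * (a * (a * (a * 1ℚ))))))))
    eB = solve-∀ ℚ-ring

-- The product of x³ + a x² + b x + d and x³ + a′ x² + b′ x + d′ is even. Eliminating a′ and d′ leaves
-- (b - b′) (a b - d) = 0, and d = a b would make -a a root of the first factor.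
cubic-factors⇒parameter : ∀ {v c d b a d′ b′ a′} → v ≢ 0ℚ → c ≢ 0ℚ →
  d + - a * (b + - a * (a + - a * (1ℚ + - a * 0ℚ))) ≢ 0ℚ →
  d * d′ + 0ℚ ≡ c →
  d * b′ + (b * d′ + 0ℚ) ≡ 0ℚ →
  d * a′ + (b * b′ + (a * d′ + 0ℚ)) ≡ v * v →
  d * 1ℚ + (b * a′ + (a * b′ + (1ℚ * d′ + 0ℚ))) ≡ 0ℚ →
  b * 1ℚ + (a * a′ + 1ℚ * b′) ≡ v →
  a * 1ℚ + 1ℚ * a′ ≡ 0ℚ →
  ∃[ q ] (q ≢ 1ℚ × q ≢ ½ × q ≢ ⅓ × EqualUpToScaling (c - v * v * v , - (v * c)) (A⟨ q ⟩ , B⟨ q ⟩))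
cubic-factors⇒parameter {v} {c} {d} {b} {a} {d′} {b′} {a′} v≢0 c≢0 -a-not-root h₀ h₁ h₂ h₃ h₄ h₅ =
  b * (1/ a * 1/ a) , parameter-scaling (b * (1/ a * 1/ a)) v≢0 c≢0 a≢0 b≡ v≡ c≡ 2ad≡
  where
  a′≡ : a′ ≡ - a
  a′≡ = combine₁ 1 h₅ (e a a′)
    where
    e : ∀ a a′ → a′ - - a ≡ 1 * (a * 1ℚ + 1ℚ * a′ - 0)
    e = solve-∀ ℚ-ring
  d′≡ : d′ ≡ a * b - a * b′ - d
  d′≡ = combine₂ 1 h₃ (- b) a′≡ (e d b a d′ b′ a′)
    where
    e : ∀ d b a d′ b′ a′ → d′ - (a * b - a * b′ - d) ≡
          1 * (d * 1ℚ + (b * a′ + (a * b′ + (1ℚ * d′ + 0ℚ))) - 0) + - b * (a′ - - a)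
    e = solve-∀ ℚ-ring
  b′≡b : b′ ≡ b
  b′≡b = sym (x-y≡0⇒x≡y b b′ (x*y≡0⇒x≡0 (b - b′) (a * b - d) ab-d≢0 (combine₂ 1 h₁ (- b) d′≡ (e d b a d′ b′))))
    where
    e : ∀ d b a d′ b′ → (b - b′) * (a * b - d) - 0 ≡
          1 * (d * b′ + (b * d′ + 0ℚ) - 0) + - b * (d′ - (a * b - a * b′ - d))
    e = solve-∀ ℚ-ring
    ab-d≢0 : a * b - d ≢ 0ℚ
    ab-d≢0 eq = -a-not-root (combine₁ (- 1) eq (e′ d b a))
      where
      e′ : ∀ d b a → d + - a * (b + - a * (a + - a * (1ℚ + - a * 0ℚ))) - 0 ≡ - 1 * (a * b - d - 0)
      e′ = solve-∀ ℚ-ring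
  d′≡-d : d′ ≡ - d
  d′≡-d = combine₂ 1 d′≡ (- a) b′≡b (e d b a d′ b′)
    where
    e : ∀ d b a d′ b′ → d′ - - d ≡ 1 * (d′ - (a * b - a * b′ - d)) + - a * (b′ - b)
    e = solve-∀ ℚ-ring
  v≡ : v ≡ 2 * b - a * a
  v≡ = combine₃ (- 1) h₄ 1 b′≡b a a′≡ (e b a v b′ a′)
    where
    e : ∀ b a v b′ a′ → v - (2 * b - a * a) ≡
          - 1 * (b * 1ℚ + (a * a′ + 1ℚ * b′) - v) + 1 * (b′ - b) + a * (a′ - - a)
    e = solve-∀ ℚ-ring
  c≡ : c ≡ - (d * d)
  c≡ = combine₂ (- 1) h₀ d d′≡-d (e d d′ c)
    where
    e : ∀ d d′ c → c - - (d * d) ≡ - 1 * (d * d′ + 0ℚ - c) + d * (d′ - - d)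
    e = solve-∀ ℚ-ring
  vv≡ : v * v ≡ d * a′ + b * b - a * d
  vv≡ = combine₃ (- 1) h₂ b b′≡b a d′≡-d (e d b a v d′ b′ a′)
    where
    e : ∀ d b a v d′ b′ a′ → v * v - (d * a′ + b * b - a * d) ≡
          - 1 * (d * a′ + (b * b′ + (a * d′ + 0ℚ)) - v * v) + b * (b′ - b) + a * (d′ - - d)
    e = solve-∀ ℚ-ring
  2ad≡ : 2 * (a * d) ≡ b * b - v * v
  2ad≡ = combine₂ 1 vv≡ d a′≡ (e′ d b a v a′)
    where
    e′ : ∀ d b a v a′ → 2 * (a * d) - (b * b - v * v) ≡
          1 * (v * v - (d * a′ + b * b - a * d)) + d * (a′ - - a)
    e′ = solve-∀ ℚ-ring
  a≢0 : a ≢ 0ℚ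
  -- For a = 0 the relations become v = 2 b and b² = v², so 3 v² = 0.
  a≢0 a≡0 = v≢0 (square≡0⇒≡0 v (combine₃ (⅓ * 4) 2ad≡ (- (⅓ * (v + a * a + 2 * b))) v≡
    (- (⅓ * (8 * d - 2 * a * v - a * a * a))) a≡0 (e d b a v)))
    where
    e : ∀ d b a v → v * v - 0 ≡ ⅓ * 4 * (2 * (a * d) - (b * b - v * v)) +
          - (⅓ * (v + a * a + 2 * b)) * (v - (2 * b - a * a)) + - (⅓ * (8 * d - 2 * a * v - a * a * a)) * (a - 0)
    e = solve-∀ ℚ-ring
  instance
    a-nonZero : NonZero a
    a-nonZero = ≢-nonZero a≢0
  b≡ : b ≡ b * (1/ a * 1/ a) * (a * a)
  b≡ = sym (begin
    b * (1/ a * 1/ a) * (a * a)      ≡⟨ e b (1/ a) a ⟩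
    b * (1/ a * a * (1/ a * a))      ≡⟨ cong (λ z → b * (z * z)) (*-inverseˡ a) ⟩
    b * (1ℚ * 1ℚ)                    ≡⟨ *-identityʳ b ⟩
    b                                ∎)
    where
    open ≡-Reasoning
    e : ∀ b i a → b * (i * i) * (a * a) ≡ b * (i * a * (i * a))
    e = solve-∀ ℚ-ring

-- If v (v + b)² = (a v + d)², then v is the square of w = (a v + d) / (v + b), and -w is a root of the cubic.
rootless⇒resolvent-rootless : ∀ {d b a} → (∀ w → d + w * (b + w * (a + w * (1ℚ + w * 0ℚ))) ≢ 0ℚ) →
  ∀ v → v * ((v + b) * (v + b)) ≢ (a * v + d) * (a * v + d)
rootless⇒resolvent-rootless {d} {b} {a} rootless v eq =
  rootless (- w) (combine₂ (a - w) ww≡v (- 1) w[v+b]≡ (e d b a v w))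
  where
  -- If v + b = 0, then a v + d = 0 as well, so d = a b and the cubic is (x + a) (x² + b).
  v+b≢0 : v + b ≢ 0ℚ
  v+b≢0 v+b≡0 = rootless (- a) (combine₂ 1 av+d≡0 (- a) v+b≡0 (e₁ d b a v))
    where
    e₁ : ∀ d b a v → d + - a * (b + - a * (a + - a * (1ℚ + - a * 0ℚ))) - 0 ≡ 1 * (a * v + d - 0) + - a * (v + b - 0)
    e₁ = solve-∀ ℚ-ring
    e₂ : ∀ d b a v → (a * v + d) * (a * v + d) - 0 ≡
           - 1 * (v * ((v + b) * (v + b)) - (a * v + d) * (a * v + d)) + v * (v + b) * (v + b - 0)
    e₂ = solve-∀ ℚ-ring
    av+d≡0 : a * v + d ≡ 0ℚ
    av+d≡0 = square≡0⇒≡0 (a * v + d) (combine₂ (- 1) eq (v * (v + b)) v+b≡0 (e₂ d b a v))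
  instance
    v+b-nonZero : NonZero (v + b)
    v+b-nonZero = ≢-nonZero v+b≢0
  j w : ℚ
  j = 1/ (v + b)
  w = (a * v + d) * j
  w[v+b]≡ : w * (v + b) ≡ a * v + d
  w[v+b]≡ = trans (*-assoc (a * v + d) j (v + b))
    (trans (cong ((a * v + d) *_) (*-inverseˡ (v + b))) (*-identityʳ (a * v + d)))
  ww≡v : w * w ≡ v
  ww≡v = begin
    (a * v + d) * j * ((a * v + d) * j)          ≡⟨ e₁ (a * v + d) j ⟩
    (a * v + d) * (a * v + d) * (j * j)          ≡⟨ cong (_* (j * j)) eq ⟨
    v * ((v + b) * (v + b)) * (j * j)            ≡⟨ e₂ v (v + b) j ⟩
    v * (j * (v + b) * (j * (v + b)))            ≡⟨ cong (λ z → v * (z * z)) (*-inverseˡ (v + b)) ⟩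
    v * (1ℚ * 1ℚ)                                ≡⟨ *-identityʳ v ⟩
    v                                            ∎
    where
    open ≡-Reasoning
    e₁ : ∀ x j → x * j * (x * j) ≡ x * x * (j * j)
    e₁ = solve-∀ ℚ-ring
    e₂ : ∀ v y j → v * (y * y) * (j * j) ≡ v * (j * y * (j * y))
    e₂ = solve-∀ ℚ-ring
  e : ∀ d b a v w → d + - w * (b + - w * (a + - w * (1ℚ + - w * 0ℚ))) - 0 ≡
        (a - w) * (w * w - v) + - 1 * (w * (v + b) - (a * v + d))
  e = solve-∀ ℚ-ring

-- The quartic is y - v₀ times y (y + b)² - (t y + δ)². At y = x² the second factor is - f(x) f(-x)
-- for the cubic f = x³ + t x² + b x + δ, and it has no rational root because f has none. The
-- products ending in `1ℚ` are the unfolded powers of t.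
quartic-root-unique : ∀ {q t} → q ≢ 1ℚ → q ≢ ½ → q ≢ ⅓ → t ≢ 0ℚ → ∀ v →
  B⟨ q ⟩ * (t * (t * (t * (t * (t * (t * (t * (t * 1ℚ)))))))) +
  v * (A⟨ q ⟩ * (t * (t * (t * (t * (t * (t * 1ℚ)))))) + v * (0 + v * (0 + v * (1ℚ + v * 0ℚ)))) ≡ 0ℚ →
  v ≡ (2 * q - 1) * (t * t)
quartic-root-unique {q} {t} q≢1 q≢½ q≢⅓ t≢0 v root =
  x-y≡0⇒x≡y _ _ (x*y≡0⇒x≡0 (v - v₀) (v * ((v + b) * (v + b)) - (t * v + δ) * (t * v + δ))
    (rootless⇒resolvent-rootless {δ} {b} {t} (cubic-rootless q≢1 q≢½ q≢⅓ t≢0) v ∘ x-y≡0⇒x≡y _ _)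
    (trans (e q t v) root))
  where
  v₀ b δ : ℚ
  v₀ = (2 * q - 1) * (t * t)
  b = q * (t * t)
  δ = δ⟨ q , t ⟩
  e : ∀ q t v → (v - (2 * q - 1) * (t * t)) * (v * ((v + q * (t * t)) * (v + q * (t * t))) -
        (t * v + - (½ * ((q - 1) * (3 * q - 1) * (t * t * t)))) *
        (t * v + - (½ * ((q - 1) * (3 * q - 1) * (t * t * t))))) ≡
      (q - 1) * ((q - 1) * 1ℚ) * (2 * q - 1) * ((3 * q - 1) * ((3 * q - 1) * 1ℚ)) * ¼ *
      (t * (t * (t * (t * (t * (t * (t * (t * 1ℚ)))))))) +
      v * (- ((q * (q * 1ℚ) + 2 * q - 1) * (9 * (q * (q * 1ℚ)) - 10 * q + 3) * ¼) *
        (t * (t * (t * (t * (t * (t * 1ℚ)))))) + v * (0 + v * (0 + v * (1ℚ + v * 0ℚ))))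
  e = solve-∀ ℚ-ring

-- The quotient polynomial

-- The cubic h(y) with constant term c = v³ + A; `sextic` is h(x²).
resolvent : ℚ → ℚ → Poly
resolvent A v = v * v * v + A ∷ v * v ∷ v ∷ 1ℚ ∷ []

sextic : ℚ → ℚ → Poly
sextic A v = v * v * v + A ∷ 0ℚ ∷ v * v ∷ 0ℚ ∷ v ∷ 0ℚ ∷ 1ℚ ∷ []

quartic-root⇒B≡ : ∀ A B v → IsRoot (quartic A B) v → B ≡ - (v * (v * v * v + A))
quartic-root⇒B≡ A B v root = combine₁ 1 root (e A B v)
  where
  e : ∀ A B v → B - - (v * (v * v * v + A)) ≡ 1 * (B + v * (A + v * (0 + v * (0 + v * (1 + v * 0ℚ)))) - 0)
  e = solve-∀ ℚ-ring

quartic-factors : ∀ A B v → IsRoot (quartic A B) v → quartic A B ≈ (- v ∷ 1ℚ ∷ []) ⊛ resolvent A v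
quartic-factors A B v root = λ
  { 0 → trans (quartic-root⇒B≡ A B v root) (e₀ v (v * v * v + A))
  ; 1 → e₁ A v
  ; 2 → e₂ v
  ; 3 → e₃ v
  ; 4 → refl
  ; (suc (suc (suc (suc (suc _))))) → refl
  }
  where
  e₀ : ∀ v c → - (v * c) ≡ - v * c + 0ℚ
  e₀ = solve-∀ ℚ-ring
  e₁ : ∀ A v → A ≡ - v * (v * v) + (1ℚ * (v * v * v + A) + 0ℚ)
  e₁ = solve-∀ ℚ-ring
  e₂ : ∀ v → 0ℚ ≡ - v * v + 1ℚ * (v * v)
  e₂ = solve-∀ ℚ-ring
  e₃ : ∀ v → 0ℚ ≡ - v * 1ℚ + 1ℚ * v
  e₃ = solve-∀ ℚ-ring

octic-factors : ∀ A B v → IsRoot (quartic A B) v → IsQuotient A B v (sextic A v)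
octic-factors A B v root = λ
  { 0 → trans (quartic-root⇒B≡ A B v root) (e₀ v (v * v * v + A))
  ; 1 → e₁ v (v * v * v + A)
  ; 2 → e₂ A v
  ; 3 → e₃ v (v * v)
  ; 4 → e₄ v
  ; 5 → e₃ v v
  ; 6 → e₆ v
  ; 7 → refl
  ; 8 → refl
  ; (suc (suc (suc (suc (suc (suc (suc (suc (suc _))))))))) → refl
  }
  where
  e₀ : ∀ v c → - (v * c) ≡ - v * c + 0ℚ
  e₀ = solve-∀ ℚ-ring
  e₁ : ∀ v c → 0ℚ ≡ - v * 0ℚ + (0ℚ * c + 0ℚ)
  e₁ = solve-∀ ℚ-ring
  e₂ : ∀ A v → A ≡ - v * (v * v) + (0ℚ * 0ℚ + (1ℚ * (v * v * v + A) + 0ℚ))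
  e₂ = solve-∀ ℚ-ring
  e₃ : ∀ v w → 0ℚ ≡ - v * 0ℚ + (0ℚ * w + 1ℚ * 0ℚ)
  e₃ = solve-∀ ℚ-ring
  e₄ : ∀ v → 0ℚ ≡ - v * v + (0ℚ * 0ℚ + 1ℚ * (v * v))
  e₄ = solve-∀ ℚ-ring
  e₆ : ∀ v → 0ℚ ≡ - v * 1ℚ + (0ℚ * 0ℚ + 1ℚ * v)
  e₆ = solve-∀ ℚ-ring

-- Cancelling x² - v determines the quotient up to `_≈_`, so later arguments can use an explicit
-- coefficient list.
quotient≈sextic : ∀ A B v g → IsRoot (quartic A B) v → IsQuotient A B v g → g ≈ sextic A v
quotient≈sextic A B v g root quot = cancel-x²-v v g (sextic A v)
  (≈-trans (x²-v ⊛ g) (octic A B) (x²-v ⊛ sextic A v) (≈-sym (octic A B) (x²-v ⊛ g) quot) (octic-factors A B v root))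
  where
  x²-v : Poly
  x²-v = - v ∷ 0ℚ ∷ 1ℚ ∷ []

sextic-degree : ∀ A v → HasDegree (sextic A v) 6
sextic-degree A v = (λ ()) , above
  where
  above : ∀ m → 6 ℕ.< m → coeff (sextic A v) m ≡ 0ℚ
  above (suc (suc (suc (suc (suc (suc (suc m))))))) _ = refl
  above 6 6<6 = ⊥-elim (ℕ.<-irrefl refl 6<6)
  above 5 (s≤s (s≤s (s≤s (s≤s (s≤s ())))))
  above 4 (s≤s (s≤s (s≤s (s≤s ()))))
  above 3 (s≤s (s≤s (s≤s ())))
  above 2 (s≤s (s≤s ()))
  above 1 (s≤s ())
  above 0 ()

sextic-root⇒resolvent-root : ∀ A v w → IsRoot (sextic A v) w → IsRoot (resolvent A v) (w * w)
sextic-root⇒resolvent-root A v w = trans (e (v * v * v + A) v w)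
  where
  e : ∀ c v w → c + w * w * (v * v + w * w * (v + w * w * (1ℚ + w * w * 0ℚ))) ≡
        c + w * (0ℚ + w * (v * v + w * (0ℚ + w * (v + w * (0ℚ + w * (1ℚ + w * 0ℚ))))))
  e = solve-∀ ℚ-ring

quadratic∤sextic : ∀ A v → (∀ w → ¬ IsRoot (resolvent A v) w) → ∀ f k → HasDegree f 2 → HasDegree k 4 →
  ¬ (sextic A v ≈ f ⊛ k)
quadratic∤sextic A v rootless f k deg-f deg-k s≈fk =
  let c , d , _ , _ , s≈ , _ = monic-factors (sextic A v) f k deg-f deg-k refl s≈fk
      cf = coeff (map (c *_) f)
      dk = coeff (map (d *_) k)
      r , root = quadratic-factor⇒root {cf 0} {cf 1} {dk 0} {dk 1} {dk 2} {dk 3} {v}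
        (sym (s≈ 0)) (sym (s≈ 1)) (sym (s≈ 2)) (sym (s≈ 3)) (sym (s≈ 4)) (sym (s≈ 5))
  in rootless r root

type-3-3 : ∀ A v g f k → g ≈ sextic A v → g ≈ f ⊛ k → HasDegree f 3 → HasDegree k 3 →
  (∀ w → ¬ IsRoot f w) → (∀ w → ¬ IsRoot k w) → HasReducibilityType g (3 ∷ 3 ∷ [])
type-3-3 A v g f k g≈s g≈fk deg-f deg-k f-rootless k-rootless =
  (6 , HasDegree-cong (sextic A v) g (≈-sym g (sextic A v) g≈s) (sextic-degree A v) , g≈s 6) ,
  ℕ.≤-refl ∷ [-] ,
  f ∷ k ∷ [] ,
  -- The product over the list of factors ends in `1#`.
  ≈-trans g (f ⊛ k) (f ⊛ (k ⊛ 1#)) g≈fk (⊛-congˡ f k (k ⊛ 1#) (≈-sym (k ⊛ 1#) k (⊛-identityʳ k))) ,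
  (rootless-cubic-irreducible f deg-f f-rootless , deg-f) ∷
  (rootless-cubic-irreducible k deg-k k-rootless , deg-k) ∷ []

-- A linear factor has a root w, and w² is then a root of h; a quadratic factor also yields a root
-- of h. Only degrees 3 and 3 remain, and rootless cubics are irreducible.
reducible⇒type-3-3 : ∀ A v g → g ≈ sextic A v → (∀ w → ¬ IsRoot (resolvent A v) w) → Reducible g →
  HasReducibilityType g (3 ∷ 3 ∷ [])
reducible⇒type-3-3 A v g g≈s rootless (_ , f , k , g≈fk , f∤1 , k∤1) =
  by-degree (degrees-of-factors (sextic A v) f k (sextic-degree A v) s≈fk)
  where
  s≈fk : sextic A v ≈ f ⊛ k
  s≈fk = ≈-trans (sextic A v) g (f ⊛ k) (≈-sym g (sextic A v) g≈s) g≈fk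
  s≈kf : sextic A v ≈ k ⊛ f
  s≈kf = ≈-trans (sextic A v) (f ⊛ k) (k ⊛ f) s≈fk (⊛-comm f k)
  f-rootless : ∀ w → ¬ IsRoot f w
  f-rootless w fw≡0 = rootless (w * w) (sextic-root⇒resolvent-root A v w (root-⊛ˡ (sextic A v) f k w s≈fk fw≡0))
  k-rootless : ∀ w → ¬ IsRoot k w
  k-rootless w kw≡0 = rootless (w * w) (sextic-root⇒resolvent-root A v w (root-⊛ˡ (sextic A v) k f w s≈kf kw≡0))
  by-degree : ∃[ m ] ∃[ n ] (HasDegree f m × HasDegree k n × m ℕ.+ n ≡ 6) → HasReducibilityType g (3 ∷ 3 ∷ [])
  by-degree (0 , _ , deg-f , _) = ⊥-elim (f∤1 (degree-0⇒unit f deg-f))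
  by-degree (1 , _ , deg-f , _) = let w , fw≡0 = linear-root f deg-f in ⊥-elim (f-rootless w fw≡0)
  by-degree (2 , .4 , deg-f , deg-k , refl) = ⊥-elim (quadratic∤sextic A v rootless f k deg-f deg-k s≈fk)
  by-degree (3 , .3 , deg-f , deg-k , refl) = type-3-3 A v g f k g≈s g≈fk deg-f deg-k f-rootless k-rootless
  by-degree (4 , .2 , deg-f , deg-k , refl) = ⊥-elim (quadratic∤sextic A v rootless k f deg-k deg-f s≈kf)
  by-degree (5 , .1 , _ , deg-k , refl) = let w , kw≡0 = linear-root k deg-k in ⊥-elim (k-rootless w kw≡0)
  by-degree (6 , .0 , _ , deg-k , refl) = ⊥-elim (k∤1 (degree-0⇒unit k deg-k))
  by-degree (suc (suc (suc (suc (suc (suc (suc _)))))) , _ , _ , _ , ())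

-- Type (3,3) and the parametrisation.

Parametrised : ℚ → ℚ → Set
Parametrised A B = ∃[ q ] (q ≢ 1ℚ × q ≢ ½ × q ≢ ⅓ × EqualUpToScaling (A , B) (A⟨ q ⟩ , B⟨ q ⟩))

type-3-3⇒parametrised : ∀ A B v g → A * B ≢ 0ℚ → v ≢ 0ℚ → IsRoot (quartic A B) v → g ≈ sextic A v →
  HasReducibilityType g (3 ∷ 3 ∷ []) → Parametrised A B
type-3-3⇒parametrised A B v g AB≢0 v≢0 root g≈s (_ , _ , f ∷ k ∷ [] , g≈ , (f-irr , deg-f) ∷ (_ , deg-k) ∷ []) =
  let s≈fk : sextic A v ≈ f ⊛ k
      s≈fk i = trans (sym (g≈s i)) (trans (g≈ i) (⊛-congˡ f (k ⊛ 1#) k (⊛-identityʳ k) i))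
      c , d , c≢0 , _ , s≈ , cf≈ , _ = monic-factors (sextic A v) f k deg-f deg-k refl s≈fk
      cf = map (c *_) f
      cf-rootless : ∀ r → ¬ IsRoot cf r
      cf-rootless r cfr≡0 = irreducible-cubic-rootless f deg-f f-irr r
        (x*y≡0⇒x≡0 (eval f r) c c≢0 (trans (*-comm (eval f r) c) (trans (sym (eval-map c f r)) cfr≡0)))
      dk = map (d *_) k
      -- The one point where `cubic-factors⇒parameter` needs the first cubic not to vanish: minus
      -- its coefficient of x².
      a = - coeff cf 2
  in subst₂ Parametrised (A≡ v A) (sym (quartic-root⇒B≡ A B v root))
       (cubic-factors⇒parameter {v} {v * v * v + A}
         {coeff cf 0} {coeff cf 1} {coeff cf 2} {coeff dk 0} {coeff dk 1} {coeff dk 2}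
         v≢0 const≢0
         (λ r → cf-rootless a (trans (eval-cong cf (applyUpTo (coeff cf) 3 ++ 1ℚ ∷ []) a cf≈) r))
         (sym (s≈ 0)) (sym (s≈ 1)) (sym (s≈ 2)) (sym (s≈ 3)) (sym (s≈ 4)) (sym (s≈ 5)))
  where
  A≡ : ∀ v A → v * v * v + A - v * v * v ≡ A
  A≡ = solve-∀ ℚ-ring
  -- B = - v (v³ + A) is non-zero.
  const≢0 : v * v * v + A ≢ 0ℚ
  const≢0 eq = AB≢0 (combine₂ A (quartic-root⇒B≡ A B v root) (- (A * v)) eq (e A B v))
    where
    e : ∀ A B v → A * B - 0 ≡ A * (B - - (v * (v * v * v + A))) + - (A * v) * (v * v * v + A - 0)
    e = solve-∀ ℚ-ring

parametrised⇒type-3-3 : ∀ A B v g → IsRoot (quartic A B) v → g ≈ sextic A v →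
  Parametrised A B → HasReducibilityType g (3 ∷ 3 ∷ [])
parametrised⇒type-3-3 _ _ v g root g≈s (q , q≢1 , q≢½ , q≢⅓ , t , t≢0 , refl , refl) =
  -- The given root v must be v₀, the value for which f and k multiply to the sextic.
  with-root (quartic-root-unique q≢1 q≢½ q≢⅓ t≢0 v root) g≈s
  where
  A v₀ b δ : ℚ
  A = A⟨ q ⟩ * (t * (t * (t * (t * (t * (t * 1ℚ))))))
  v₀ = (2 * q - 1) * (t * t)
  b = q * (t * t)
  δ = δ⟨ q , t ⟩
  f k : Poly
  f = δ ∷ b ∷ t ∷ 1ℚ ∷ []
  -- k(x) = - f(-x), so its roots are the negatives of those of f.
  k = - δ ∷ b ∷ - t ∷ 1ℚ ∷ []
  f-rootless : ∀ w → ¬ IsRoot f w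
  f-rootless = cubic-rootless q≢1 q≢½ q≢⅓ t≢0
  k-rootless : ∀ w → ¬ IsRoot k w
  k-rootless w kw≡0 = f-rootless (- w) (combine₁ (- 1) kw≡0 (e δ b t w))
    where
    e : ∀ δ b t w → δ + - w * (b + - w * (t + - w * (1ℚ + - w * 0ℚ))) - 0 ≡
          - 1 * (- δ + w * (b + w * (- t + w * (1ℚ + w * 0ℚ))) - 0)
    e = solve-∀ ℚ-ring
  cubic-degree : ∀ a b c → HasDegree (a ∷ b ∷ c ∷ 1ℚ ∷ []) 3
  cubic-degree a b c = (λ ()) , λ
    { (suc (suc (suc (suc _)))) _ → refl
    ; 3 (s≤s (s≤s (s≤s ())))
    ; 2 (s≤s (s≤s ()))
    ; 1 (s≤s ())
    }
  sextic≈ : sextic A v₀ ≈ f ⊛ k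
  sextic≈ = λ
    { 0 → e₀ q t
    ; 1 → e₁ δ b
    ; 2 → e₂ q t
    ; 3 → e₃ δ b t
    ; 4 → e₄ q t
    ; 5 → e₅ t
    ; 6 → refl
    ; (suc (suc (suc (suc (suc (suc (suc _))))))) → refl
    }
    where
    e₀ : ∀ q t →
      (2 * q - 1) * (t * t) * ((2 * q - 1) * (t * t)) * ((2 * q - 1) * (t * t)) +
      - ((q * (q * 1ℚ) + 2 * q - 1) * (9 * (q * (q * 1ℚ)) - 10 * q + 3) * ¼) *
      (t * (t * (t * (t * (t * (t * 1ℚ)))))) ≡
      - (½ * ((q - 1) * (3 * q - 1) * (t * t * t))) * - - (½ * ((q - 1) * (3 * q - 1) * (t * t * t))) + 0ℚ
    e₀ = solve-∀ ℚ-ring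
    e₁ : ∀ δ b → 0ℚ ≡ δ * b + (b * - δ + 0ℚ)
    e₁ = solve-∀ ℚ-ring
    e₂ : ∀ q t → (2 * q - 1) * (t * t) * ((2 * q - 1) * (t * t)) ≡
      - (½ * ((q - 1) * (3 * q - 1) * (t * t * t))) * - t +
      (q * (t * t) * (q * (t * t)) + (t * - - (½ * ((q - 1) * (3 * q - 1) * (t * t * t))) + 0ℚ))
    e₂ = solve-∀ ℚ-ring
    e₃ : ∀ δ b t → 0ℚ ≡ δ * 1ℚ + (b * - t + (t * b + (1ℚ * - δ + 0ℚ)))
    e₃ = solve-∀ ℚ-ring
    e₄ : ∀ q t → (2 * q - 1) * (t * t) ≡ q * (t * t) * 1ℚ + (t * - t + 1ℚ * (q * (t * t)))
    e₄ = solve-∀ ℚ-ring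
    e₅ : ∀ t → 0ℚ ≡ t * 1ℚ + 1ℚ * - t
    e₅ = solve-∀ ℚ-ring
  with-root : ∀ {v} → v ≡ v₀ → g ≈ sextic A v → HasReducibilityType g (3 ∷ 3 ∷ [])
  with-root refl g≈ = type-3-3 A v₀ g f k g≈ (≈-trans g (sextic A v₀) (f ⊛ k) g≈ sextic≈)
    (cubic-degree δ b t) (cubic-degree (- δ) b (- t)) f-rootless k-rootless

theorem6p1 : (A B v : ℚ) → A * B ≢ 0ℚ → v ≢ 0ℚ → IsRoot (quartic A B) v →
    (g : Poly) → IsQuotient A B v g →
    (IsSoleRoot (quartic A B) v → Reducible g → HasReducibilityType g (3 ∷ 3 ∷ [])) ×
    (HasReducibilityType g (3 ∷ 3 ∷ []) ⇔
    (∃[ q ] (q ≢ 1ℚ × q ≢ ½ × q ≢ ⅓ × EqualUpToScaling (A , B) (A⟨ q ⟩ , B⟨ q ⟩))))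
theorem6p1 A B v AB≢0 v≢0 root g quot =
  -- The cofactor of x - v in the quartic is h, so the sole-root hypothesis says that h has no
  -- rational root.
  (λ (_ , rootless) → reducible⇒type-3-3 A v g g≈s (rootless (resolvent A v) (quartic-factors A B v root))) ,
  mk⇔ (type-3-3⇒parametrised A B v g AB≢0 v≢0 root g≈s) (parametrised⇒type-3-3 A B v g root g≈s)
  where
  g≈s : g ≈ sextic A v
  g≈s = quotient≈sextic A B v g root quot
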